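{- Let $G$ be a graph of order at least three. If for every $S\subseteq V(G)$, $$\omega(G\setminus S)\le \min \Big\{\frac{2}{7}|S|,\ \frac{1}{2}|S|-\frac{3}{2}\, iso(G\setminus S)\Big\}+1,$$ then $G$ admits a connected $\{2,4\}$-factor.
   Context: Graphs are finite, loopless, and may have multiple edges. $\omega(H)$ denotes the number of components of $H$ and $iso(H)$ the number of isolated vertices of $H$; $G\setminus S$ is obtained by deleting the vertices in $S$. A $\{2,4\}$-factor is a spanning subgraph in which every vertex has degree $2$ or $4$. -}

module Defs where

open import Data.Nat using (ℕ; zero; suc; _+_; _*_; _≤_; _<_)
open import Data.Fin using (Fin)
open import Data.Fin.Subset using (Subset; _∈_; _∉_; ∣_∣; ⊥)
open import Data.Bool using (Bool; true; false; if_then_else_)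
open import Data.Vec using (lookup)
open import Data.Product using (Σ; ∃; _×_; _,_)
open import Data.Sum using (_⊎_)
open import Relation.Binary.PropositionalEquality using (_≡_)
open import Function.Bundles using (_⇔_)

-- A finite loopless multigraph on vertex set Fin n, given by its edge
-- multiplicity function (mult u v = number of edges between u and v).
record Graph (n : ℕ) : Set where
  field
    mult      : Fin n → Fin n → ℕ
    symmetric : ∀ u v → mult u v ≡ mult v u
    loopless  : ∀ v → mult v v ≡ 0
open Graph public

sumFin : ∀ {n} → (Fin n → ℕ) → ℕ
sumFin {zero}  f = 0
sumFin {suc n} f = f Fin.zero + sumFin {n} (λ i → f (Fin.suc i))

degOutside : ∀ {n} → (Fin n → Fin n → ℕ) → Subset n → Fin n → ℕ
degOutside m S v = sumFin (λ u → if lookup S u then 0 else m v u)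

isZero : ℕ → Bool
isZero zero    = true
isZero (suc _) = false

iso : ∀ {n} → Graph n → Subset n → ℕ
iso G S = sumFin (λ v → if lookup S v then 0
                         else (if isZero (degOutside (mult G) S v) then 1 else 0))

data Reach {n : ℕ} (m : Fin n → Fin n → ℕ) (S : Subset n) : Fin n → Fin n → Set where
  here : ∀ {v} → v ∉ S → Reach m S v v
  step : ∀ {u w v} → u ∉ S → w ∉ S → 0 < m u w → Reach m S w v → Reach m S u v

-- G ∖ S has exactly c components: a labelling of the vertices outside S by
-- Fin c, onto, such that two vertices get the same label iff they are
-- connected in G ∖ S.  (c is uniquely determined, so this defines ω(G ∖ S).)
HasComponents : ∀ {n} → Graph n → Subset n → ℕ → Set
HasComponents {n} G S c =
  Σ (Fin n → Fin c) λ label →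
    (∀ (k : Fin c) → ∃ λ v → v ∉ S × label v ≡ k) ×
    (∀ u v → u ∉ S → v ∉ S → (label u ≡ label v ⇔ Reach (mult G) S u v))

record Connected24Factor {n : ℕ} (G : Graph n) : Set where
  field
    F         : Fin n → Fin n → ℕ
    F-sym     : ∀ u v → F u v ≡ F v u
    F-sub     : ∀ u v → F u v ≤ mult G u v
    degree    : ∀ v → degOutside F ⊥ v ≡ 2 ⊎ degOutside F ⊥ v ≡ 4
    connected : ∀ u v → Reach F ⊥ u v

{-# OPTIONS --safe #-}

-- A spanning subgraph H that contains two edge-disjoint connected spanning
-- subgraphs A, B and has maximum degree at most 5 suffices: adding to A a
-- T-join of B, where T is the set of odd vertices of A, makes all degrees even,
-- hence 2 or 4.  Such an H is a base of the union of two graphic matroids, that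
-- is, a (2,2)-tight graph.  Bases with small degrees are found by local search
-- in the manner of Fürer and Raghavachari: if no exchange lowers the degrees,
-- there is a vertex set U outside which all degrees are at least 5, such that
-- all edges of G between different maximal tight subsets of U lie in H.
-- Counting edges, U then splits into too many parts with too few edges between
-- them.  The hypothesis excludes this: moving vertices with edges between parts
-- out of U leaves many components, and many of them are isolated vertices.

module Submission where

open import Defs
open import Data.Nat using (ℕ; zero; suc; _+_; _*_; _∸_; _≤_; _<_; z≤n; s≤s; _≤?_; _<?_)
open import Data.Nat.Properties hiding (_≟_)
open import Data.Nat.Properties using () renaming (_≟_ to _≟ℕ_)
open import Data.Nat.Tactic.RingSolver using (solve-∀; solve)
open import Data.Fin using (Fin; punchOut)
open import Data.Fin.Properties using (_≟_; any?; all?; ¬∀⟶∃¬; punchOut-injective; punchOut-cong)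
open import Data.Fin.Subset as Subset using (Subset; _∉_; ∣_∣)
open import Data.Fin.Subset.Properties using (anySubset?; ∉⊥)
open import Data.Bool using (Bool; true; false; if_then_else_; _∧_; _∨_; _xor_; not)
import Data.Bool.Properties as Bool
open import Data.List using ([]; _∷_)
open import Data.Maybe as Maybe using (Maybe; just; nothing; fromMaybe)
open import Data.Vec using (lookup; tabulate)
open import Data.Vec.Properties using (lookup∘tabulate; lookup-replicate; lookup⇒[]=; []=⇒lookup)
open import Data.Product using (Σ; ∃; _×_; _,_; proj₁; proj₂)
open import Data.Sum using (_⊎_; inj₁; inj₂)
open import Data.Empty using (⊥; ⊥-elim)
open import Relation.Nullary using (¬_; Dec; yes; no; does)
open import Relation.Nullary.Decidable using (dec-true; dec-false; _×-dec_; _→-dec_; ¬?; map′)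
open import Relation.Binary.PropositionalEquality using (_≡_; _≢_; refl; sym; trans; cong; cong₂; subst; subst₂; module ≡-Reasoning)
open import Function.Bundles using (mk⇔; module Equivalence)

-- The obstacle to the local search: an exchange that brings in a new edge uv raises the degrees of
-- u and v, which may already be 5. The search therefore keeps, for every vertex of U, a witness
-- that its degree can be brought down to at most 4 by changes inside some tight subset of U. If no
-- tight subset of U contains both u and v, their two witnesses live on disjoint sets, because tight
-- sets that meet have a tight union; so both can be applied at once, and then uv is added. Such
-- changes compose because a tight part may be replaced by any sparse part with equally many edges
-- without disturbing sparsity elsewhere.
--
-- The constants meet in one balance. Let S be the complement of U. Degrees of at least 5 on S leave
-- at most 2|U| - |S| - 4 edges of H inside U, whereas the hypothesis on G forces at least 2|U| -
-- |S| - 2.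
--
-- Vertex sets are boolean functions, so tightness is decidable, and least and greatest tight sets
-- are found by searching all subsets.

-- Linear inequalities, booleans and finite sums

-- A certificate for linear arithmetic: `l ≤ r` is a nonnegative combination of hypotheses, `k` a
-- slack, and the equation says a - b = l - r - k without subtraction, so that the ring solver can
-- check it.
lin : ∀ {l r a b} k → l ≤ r → a + r + k ≡ b + l → a ≤ b
lin {l} {r} {a} {b} k l≤r eq = +-cancelʳ-≤ r a b (begin
  a + r      ≤⟨ m≤m+n (a + r) k ⟩
  a + r + k  ≡⟨ eq ⟩
  b + l      ≤⟨ +-monoʳ-≤ b l≤r ⟩
  b + r      ∎)
  where open ≤-Reasoning

scale : ∀ k {a b} → a ≤ b → k * a ≤ k * b
scale k = *-monoʳ-≤ k

infixr 7 _▸_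
-- The Iverson bracket as a factor. Cardinalities and edge counts become sums of such terms, and
-- identities between them reduce to case splits on booleans.
_▸_ : Bool → ℕ → ℕ
true  ▸ k = k
false ▸ k = 0

δ : ∀ {n} → Fin n → Fin n → Bool
δ x y = does (x ≟ y)

δ-refl : ∀ {n} (x : Fin n) → δ x x ≡ true
δ-refl x = dec-true (x ≟ x) refl

δ-≢ : ∀ {n} {x y : Fin n} → x ≢ y → δ x y ≡ false
δ-≢ {x = x} {y} = dec-false (x ≟ y)

does⇒ : ∀ {P : Set} (d : Dec P) → does d ≡ true → P
does⇒ (yes p) _ = p

δ⇒≡ : ∀ {n} (x y : Fin n) → δ x y ≡ true → x ≡ y
δ⇒≡ x y = does⇒ (x ≟ y)

true≢false : {A : Set} {b : Bool} → b ≡ true → b ≡ false → A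
true≢false refl ()

∧-true : ∀ {a b} → a ∧ b ≡ true → a ≡ true × b ≡ true
∧-true {true} {true} _ = refl , refl

∧-intro : ∀ {a b} → a ≡ true → b ≡ true → a ∧ b ≡ true
∧-intro refl refl = refl

∨-introˡ : ∀ {a b} → a ≡ true → a ∨ b ≡ true
∨-introˡ refl = refl

∨-introʳ : ∀ {a b} → b ≡ true → a ∨ b ≡ true
∨-introʳ {true}  refl = refl
∨-introʳ {false} refl = refl

∨-true : ∀ {a b} → a ∨ b ≡ true → a ≡ true ⊎ b ≡ true
∨-true {true}  _ = inj₁ refl
∨-true {false} p = inj₂ p

not-false : ∀ {a} → a ≡ false → not a ≡ true
not-false refl = refl

not-true : ∀ {a} → not a ≡ true → a ≡ false
not-true {false} _ = refl

bool : ∀ b → b ≡ true ⊎ b ≡ false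
bool true  = inj₁ refl
bool false = inj₂ refl

⇔-bool : ∀ {a b} → (a ≡ true → b ≡ true) → (b ≡ true → a ≡ true) → a ≡ b
⇔-bool {true}  {true}  _ _ = refl
⇔-bool {true}  {false} f _ = sym (f refl)
⇔-bool {false} {true}  _ g = g refl
⇔-bool {false} {false} _ _ = refl

▸-zero : ∀ b → b ▸ 0 ≡ 0
▸-zero true  = refl
▸-zero false = refl

▸-≤ : ∀ b k → b ▸ k ≤ k
▸-≤ true  k = ≤-refl
▸-≤ false k = z≤n

▸-mono : ∀ {a b k l} → (a ≡ true → b ≡ true) → k ≤ l → a ▸ k ≤ b ▸ l
▸-mono {true}  {b} f k≤l rewrite f refl = k≤l
▸-mono {false} _ _ = z≤n

▸-monoʳ : ∀ b {k l} → (b ≡ true → k ≤ l) → b ▸ k ≤ b ▸ l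
▸-monoʳ true  f = f refl
▸-monoʳ false f = z≤n

▸-+ : ∀ b k l → b ▸ (k + l) ≡ b ▸ k + b ▸ l
▸-+ true  k l = refl
▸-+ false k l = refl

∑ : ∀ {n} → (Fin n → ℕ) → ℕ
∑ = sumFin

∑-cong : ∀ {n} {f g : Fin n → ℕ} → (∀ i → f i ≡ g i) → ∑ f ≡ ∑ g
∑-cong {zero}  e = refl
∑-cong {suc n} e = cong₂ _+_ (e Fin.zero) (∑-cong (λ i → e (Fin.suc i)))

∑-mono : ∀ {n} {f g : Fin n → ℕ} → (∀ i → f i ≤ g i) → ∑ f ≤ ∑ g
∑-mono {zero}  e = z≤n
∑-mono {suc n} e = +-mono-≤ (e Fin.zero) (∑-mono (λ i → e (Fin.suc i)))

∑-+ : ∀ {n} (f g : Fin n → ℕ) → ∑ (λ i → f i + g i) ≡ ∑ f + ∑ g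
∑-+ {zero}  f g = refl
∑-+ {suc n} f g rewrite ∑-+ (λ i → f (Fin.suc i)) (λ i → g (Fin.suc i)) =
  shuffle (f Fin.zero) (g Fin.zero) (∑ (λ i → f (Fin.suc i))) (∑ (λ i → g (Fin.suc i)))
  where
  shuffle : ∀ a b c d → a + b + (c + d) ≡ a + c + (b + d)
  shuffle = solve-∀

∑-* : ∀ {n} c (f : Fin n → ℕ) → ∑ (λ i → c * f i) ≡ c * ∑ f
∑-* {zero}  c f = sym (*-zeroʳ c)
∑-* {suc n} c f rewrite ∑-* c (λ i → f (Fin.suc i)) = sym (*-distribˡ-+ c (f Fin.zero) _)

∑-zero : ∀ {n} {f : Fin n → ℕ} → (∀ i → f i ≡ 0) → ∑ f ≡ 0
∑-zero {zero}  e = refl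
∑-zero {suc n} e = cong₂ _+_ (e Fin.zero) (∑-zero (λ i → e (Fin.suc i)))

∑-one : ∀ n → ∑ {n} (λ _ → 1) ≡ n
∑-one zero    = refl
∑-one (suc n) = cong suc (∑-one n)

∑-▸ : ∀ {n} b (f : Fin n → ℕ) → ∑ (λ i → b ▸ f i) ≡ b ▸ ∑ f
∑-▸ true  f = refl
∑-▸ {n} false f = ∑-zero {n} (λ _ → refl)

∑-δ : ∀ {n} (u : Fin n) (f : Fin n → ℕ) → ∑ (λ i → δ i u ▸ f i) ≡ f u
∑-δ {suc n} Fin.zero    f = trans (cong (f Fin.zero +_) (∑-zero {n} (λ _ → refl))) (+-identityʳ _)
∑-δ (Fin.suc u) f = ∑-δ u (λ i → f (Fin.suc i))

∑-swap : ∀ {m n} (f : Fin m → Fin n → ℕ) → ∑ (λ i → ∑ (λ j → f i j)) ≡ ∑ (λ j → ∑ (λ i → f i j))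
∑-swap {zero}  {n} f = sym (∑-zero {n} (λ _ → refl))
∑-swap {suc m} f rewrite ∑-swap (λ i j → f (Fin.suc i) j) =
  sym (∑-+ (f Fin.zero) (λ j → ∑ (λ i → f (Fin.suc i) j)))

∑-elem : ∀ {n} (f : Fin n → ℕ) i → f i ≤ ∑ f
∑-elem f Fin.zero    = m≤m+n _ _
∑-elem f (Fin.suc i) = ≤-trans (∑-elem (λ j → f (Fin.suc j)) i) (m≤n+m _ _)

∑-pos : ∀ {n} (f : Fin n → ℕ) → 0 < ∑ f → ∃ λ i → 0 < f i
∑-pos {suc n} f p with f Fin.zero in eq
... | suc k = Fin.zero , subst (0 <_) (sym eq) (s≤s z≤n)
... | zero with ∑-pos (λ i → f (Fin.suc i)) p
...   | i , q = Fin.suc i , q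

∑-strict : ∀ {n} {f g : Fin n → ℕ} → (∀ i → f i ≤ g i) → ∀ w → f w < g w → ∑ f < ∑ g
∑-strict e Fin.zero    lt = +-mono-<-≤ lt (∑-mono (λ i → e (Fin.suc i)))
∑-strict e (Fin.suc w) lt = +-mono-≤-< (e Fin.zero) (∑-strict (λ i → e (Fin.suc i)) w lt)

∑-unique : ∀ {n} (P : Fin n → Bool) → (∀ i j → P i ≡ true → P j ≡ true → i ≡ j) → ∑ (λ i → P i ▸ 1) ≤ 1
∑-unique {zero}  P u = z≤n
∑-unique {suc n} P u with P Fin.zero in eq
... | true = ≤-reflexive (cong suc (∑-zero z))
  where
  z : ∀ i → P (Fin.suc i) ▸ 1 ≡ 0
  z i with P (Fin.suc i) in eq′
  ... | false = refl
  ... | true with u Fin.zero (Fin.suc i) eq eq′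
  ...   | ()
... | false = ∑-unique (λ i → P (Fin.suc i)) λ i j p q → suc-inj (u _ _ p q)
  where
  suc-inj : ∀ {n} {i j : Fin n} → Fin.suc i ≡ Fin.suc j → i ≡ j
  suc-inj refl = refl

-- Double counting of the pairs `(i , φ i)`: each value of `φ` is taken at most once.
∑-injective : ∀ {n c} (P : Fin n → Bool) (φ : Fin n → Fin c) →
  (∀ i j → P i ≡ true → P j ≡ true → φ i ≡ φ j → i ≡ j) → ∑ (λ i → P i ▸ 1) ≤ c
∑-injective {n} {c} P φ inj = begin
  ∑ (λ i → P i ▸ 1)                        ≡⟨ ∑-cong (λ i → sym (trans (∑-cong (λ j → comm (P i) (δ j (φ i)))) (∑-δ (φ i) (λ _ → P i ▸ 1)))) ⟩
  ∑ (λ i → ∑ (λ j → (P i ∧ δ j (φ i)) ▸ 1)) ≡⟨ ∑-swap (λ i j → (P i ∧ δ j (φ i)) ▸ 1) ⟩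
  ∑ (λ j → ∑ (λ i → (P i ∧ δ j (φ i)) ▸ 1)) ≤⟨ ∑-mono (λ j → ∑-unique (λ i → P i ∧ δ j (φ i)) (uniq j)) ⟩
  ∑ {c} (λ _ → 1)                          ≡⟨ ∑-one c ⟩
  c ∎
  where
  open ≤-Reasoning
  comm : ∀ a b → (a ∧ b) ▸ 1 ≡ b ▸ (a ▸ 1)
  comm true  b = refl
  comm false true  = refl
  comm false false = refl
  uniq : ∀ j i i′ → P i ∧ δ j (φ i) ≡ true → P i′ ∧ δ j (φ i′) ≡ true → i ≡ i′
  uniq j i i′ p q = inj i i′ (proj₁ (∧-true p)) (proj₁ (∧-true q))
    (trans (sym (δ⇒≡ j _ (proj₂ (∧-true p)))) (δ⇒≡ j _ (proj₂ (∧-true q))))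

∑² : ∀ {n} → (Fin n → Fin n → ℕ) → ℕ
∑² f = ∑ λ x → ∑ λ y → f x y

∑²-cong : ∀ {n} {f g : Fin n → Fin n → ℕ} → (∀ x y → f x y ≡ g x y) → ∑² f ≡ ∑² g
∑²-cong e = ∑-cong λ x → ∑-cong (e x)

∑²-mono : ∀ {n} {f g : Fin n → Fin n → ℕ} → (∀ x y → f x y ≤ g x y) → ∑² f ≤ ∑² g
∑²-mono e = ∑-mono λ x → ∑-mono (e x)

∑²-+ : ∀ {n} (f g : Fin n → Fin n → ℕ) → ∑² (λ x y → f x y + g x y) ≡ ∑² f + ∑² g
∑²-+ f g = trans (∑-cong (λ x → ∑-+ (f x) (g x))) (∑-+ (λ x → ∑ (f x)) (λ x → ∑ (g x)))

∑²-zero : ∀ {n} {f : Fin n → Fin n → ℕ} → (∀ x y → f x y ≡ 0) → ∑² f ≡ 0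
∑²-zero e = ∑-zero λ x → ∑-zero (e x)

Symm : ∀ {n} → (Fin n → Fin n → ℕ) → Set
Symm m = ∀ x y → m x y ≡ m y x

-- The handshake lemma: peeling off the first vertex removes a row and an equal column.
∑²-even : ∀ {n} (f : Fin n → Fin n → ℕ) → Symm f → (∀ x → f x x ≡ 0) → ∃ λ e → ∑² f ≡ 2 * e
∑²-even {zero}  f s l = 0 , refl
∑²-even {suc n} f s l with ∑²-even (λ x y → f (Fin.suc x) (Fin.suc y)) (λ x y → s _ _) (λ x → l _)
... | e , eq = r + e , (begin
    f Fin.zero Fin.zero + r + ∑ (λ x → f (Fin.suc x) Fin.zero + ∑ (λ y → f (Fin.suc x) (Fin.suc y)))
      ≡⟨ cong₂ _+_ (cong (_+ r) (l Fin.zero)) (∑-+ (λ x → f (Fin.suc x) Fin.zero) _) ⟩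
    r + (∑ (λ x → f (Fin.suc x) Fin.zero) + ∑² (λ x y → f (Fin.suc x) (Fin.suc y)))
      ≡⟨ cong (r +_) (cong₂ _+_ (∑-cong (λ x → s (Fin.suc x) Fin.zero)) eq) ⟩
    r + (r + 2 * e)
      ≡⟨ arith r e ⟩
    2 * (r + e) ∎)
  where
  open ≡-Reasoning
  r = ∑ (λ y → f Fin.zero (Fin.suc y))
  arith : ∀ r e → r + (r + 2 * e) ≡ 2 * (r + e)
  arith = solve-∀

-- Vertex sets and multigraphs

Sub : ℕ → Set
Sub n = Fin n → Bool

Multi : ℕ → Set
Multi n = Fin n → Fin n → ℕ

infix 4 _⊆_
_⊆_ : ∀ {n} → Sub n → Sub n → Set
X ⊆ Y = ∀ x → X x ≡ true → Y x ≡ true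

full : ∀ {n} → Sub n
full _ = true

single : ∀ {n} → Fin n → Sub n
single u x = δ x u

infixl 6 _∪_ _-_
infixl 7 _∩_
_∪_ _∩_ : ∀ {n} → Sub n → Sub n → Sub n
(X ∪ Y) x = X x ∨ Y x
(X ∩ Y) x = X x ∧ Y x

_-_ : ∀ {n} → Sub n → Fin n → Sub n
(X - v) x = X x ∧ not (δ x v)

size cosize : ∀ {n} → Sub n → ℕ
size X = ∑ λ x → X x ▸ 1
cosize X = size (λ x → not (X x))

deg : ∀ {n} → Multi n → Fin n → ℕ
deg m x = ∑ (m x)

infixl 8 _↾_
_↾_ : ∀ {n} → Multi n → Sub n → Multi n
(m ↾ X) x y = (X x ∧ X y) ▸ m x y

-- Ordered pairs: D m X is twice the number of edges of m inside X.
D : ∀ {n} → Multi n → Sub n → ℕ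
D m X = ∑² (m ↾ X)

-⊆ : ∀ {n} {X : Sub n} {v} → X - v ⊆ X
-⊆ x p = proj₁ (∧-true p)

-≢ : ∀ {n} {X : Sub n} {v x} → (X - v) x ≡ true → x ≢ v
-≢ {v = v} p refl = true≢false (δ-refl v) (not-true (proj₂ (∧-true p)))

-intro : ∀ {n} {X : Sub n} {v x} → X x ≡ true → x ≢ v → (X - v) x ≡ true
-intro p q = ∧-intro p (not-false (δ-≢ q))

size-mono : ∀ {n} {X Y : Sub n} → X ⊆ Y → size X ≤ size Y
size-mono s = ∑-mono λ x → ▸-mono (s x) ≤-refl

size-cong : ∀ {n} {X Y : Sub n} → (∀ x → X x ≡ Y x) → size X ≡ size Y
size-cong e = ∑-cong λ x → cong (_▸ 1) (e x)

size-pos : ∀ {n} (X : Sub n) u → X u ≡ true → 1 ≤ size X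
size-pos X u p = ≤-trans (≤-reflexive (cong (_▸ 1) (sym p))) (∑-elem (λ x → X x ▸ 1) u)

size-⊂ : ∀ {n} {X Y : Sub n} → X ⊆ Y → ∀ w → Y w ≡ true → X w ≡ false → size X < size Y
size-⊂ s w p q = ∑-strict (λ x → ▸-mono (s x) ≤-refl) w
  (≤-reflexive (trans (cong (λ b → suc (b ▸ 1)) q) (cong (_▸ 1) (sym p))))

size-full : ∀ n → size (full {n}) ≡ n
size-full = ∑-one

size-cosize : ∀ {n} (X : Sub n) → size X + cosize X ≡ n
size-cosize {n} X = trans (sym (∑-+ (λ x → X x ▸ 1) _)) (trans (∑-cong (λ x → pt (X x))) (∑-one n))
  where
  pt : ∀ b → b ▸ 1 + not b ▸ 1 ≡ 1
  pt true  = refl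
  pt false = refl

size-single : ∀ {n} (u : Fin n) → size (single u) ≡ 1
size-single u = ∑-δ u (λ _ → 1)

size-∪∩ : ∀ {n} (X Y : Sub n) → size (X ∪ Y) + size (X ∩ Y) ≡ size X + size Y
size-∪∩ X Y = trans (sym (∑-+ (λ x → (X ∪ Y) x ▸ 1) _))
  (trans (∑-cong (λ x → pt (X x) (Y x))) (∑-+ (λ x → X x ▸ 1) _))
  where
  pt : ∀ a b → (a ∨ b) ▸ 1 + (a ∧ b) ▸ 1 ≡ a ▸ 1 + b ▸ 1
  pt true  true  = refl
  pt true  false = refl
  pt false true  = refl
  pt false false = refl

size-∪≤ : ∀ {n} (X Y : Sub n) → size (X ∪ Y) ≤ size X + size Y
size-∪≤ X Y = ≤-trans (m≤m+n _ _) (≤-reflexive (size-∪∩ X Y))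

size-remove : ∀ {n} (X : Sub n) v → X v ≡ true → size X ≡ size (X - v) + 1
size-remove X v p = trans (∑-cong pt) (trans (∑-+ (λ x → (X - v) x ▸ 1) (λ x → δ x v ▸ 1)) (cong (size (X - v) +_) (size-single v)))
  where
  pt : ∀ x → X x ▸ 1 ≡ (X - v) x ▸ 1 + δ x v ▸ 1
  pt x with δ x v in eq
  ... | true rewrite δ⇒≡ x v eq | p = refl
  ... | false with X x
  ...   | true  = refl
  ...   | false = refl

cosize-remove : ∀ {n} (X : Sub n) v → X v ≡ true → cosize (X - v) ≡ cosize X + 1
cosize-remove X v p = +-cancelˡ-≡ (size (X - v)) _ _ (trans (size-cosize (X - v))
  (trans (sym (size-cosize X)) (trans (cong (_+ cosize X) (size-remove X v p)) (assoc (size (X - v)) (cosize X)))))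
  where
  assoc : ∀ a b → a + 1 + b ≡ a + (b + 1)
  assoc = solve-∀

D-cong : ∀ {n} {m m′ : Multi n} {X Y : Sub n} → (∀ x y → m x y ≡ m′ x y) → (∀ x → X x ≡ Y x) → D m X ≡ D m′ Y
D-cong e f = ∑²-cong λ x y → cong₂ _▸_ (cong₂ _∧_ (f x) (f y)) (e x y)

D-mono : ∀ {n} {m m′ : Multi n} {X Y : Sub n} → (∀ x y → m x y ≤ m′ x y) → X ⊆ Y → D m X ≤ D m′ Y
D-mono e s = ∑²-mono λ x y → ▸-mono (λ p → ∧-intro (s x (proj₁ (∧-true p))) (s y (proj₂ (∧-true p)))) (e x y)

D-+ : ∀ {n} (m m′ : Multi n) (X : Sub n) → D (λ x y → m x y + m′ x y) X ≡ D m X + D m′ X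
D-+ m m′ X = trans (∑²-cong (λ x y → ▸-+ (X x ∧ X y) (m x y) (m′ x y))) (∑²-+ (m ↾ X) (m′ ↾ X))

D-single : ∀ {n} (m : Multi n) u → m u u ≡ 0 → D m (single u) ≡ 0
D-single m u e = ∑²-zero pt
  where
  pt : ∀ x y → (δ x u ∧ δ y u) ▸ m x y ≡ 0
  pt x y with δ x u in p | δ y u in q
  ... | false | _     = refl
  ... | true  | false = refl
  ... | true  | true  rewrite δ⇒≡ x u p | δ⇒≡ y u q = e

D-rows : ∀ {n} (m : Multi n) X → D m X ≡ ∑ (λ x → X x ▸ ∑ (λ y → X y ▸ m x y))
D-rows m X = ∑-cong λ x → trans (∑-cong (λ y → pt (X x) (X y) (m x y))) (∑-▸ (X x) (λ y → X y ▸ m x y))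
  where
  pt : ∀ a b k → (a ∧ b) ▸ k ≡ a ▸ (b ▸ k)
  pt true  b k = refl
  pt false b k = refl

-- Edges between the two differences count only on the right. It is the deficiency 4|X| - `D m X`
-- that is submodular.
D-submodular : ∀ {n} (m : Multi n) X Y → D m X + D m Y ≤ D m (X ∪ Y) + D m (X ∩ Y)
D-submodular m X Y = begin
  D m X + D m Y              ≡⟨ sym (∑²-+ (m ↾ X) (m ↾ Y)) ⟩
  ∑² (λ x y → (m ↾ X) x y + (m ↾ Y) x y) ≤⟨ ∑²-mono (λ x y → pt (X x) (X y) (Y x) (Y y) (m x y)) ⟩
  ∑² (λ x y → (m ↾ (X ∪ Y)) x y + (m ↾ (X ∩ Y)) x y) ≡⟨ ∑²-+ (m ↾ (X ∪ Y)) (m ↾ (X ∩ Y)) ⟩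
  D m (X ∪ Y) + D m (X ∩ Y)  ∎
  where
  open ≤-Reasoning
  pt : ∀ x x′ y y′ k → (x ∧ x′) ▸ k + (y ∧ y′) ▸ k ≤ ((x ∨ y) ∧ (x′ ∨ y′)) ▸ k + ((x ∧ y) ∧ (x′ ∧ y′)) ▸ k
  pt false x′    false y′    k = z≤n
  pt false x′    true  false k = z≤n
  pt false false true  true  k = m≤m+n k 0
  pt false true  true  true  k = m≤m+n k 0
  pt true  false false y′    k = z≤n
  pt true  true  false y′    k = ≤-refl
  pt true  false true  false k = z≤n
  pt true  false true  true  k = m≤m+n k 0
  pt true  true  true  y′    k = ≤-refl

Ed : ∀ {n} → Fin n → Fin n → Multi n
Ed u v x y = (δ x u ∧ δ y v) ▸ 1 + (δ x v ∧ δ y u) ▸ 1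

Ed-sym : ∀ {n} (u v : Fin n) → Symm (Ed u v)
Ed-sym u v x y = trans (+-comm ((δ x u ∧ δ y v) ▸ 1) _) (cong₂ (λ a b → a ▸ 1 + b ▸ 1) (comm (δ x v) (δ y u)) (comm (δ x u) (δ y v)))
  where
  comm : ∀ a b → a ∧ b ≡ b ∧ a
  comm true  true  = refl
  comm true  false = refl
  comm false true  = refl
  comm false false = refl

Ed-loopless : ∀ {n} {u v : Fin n} → u ≢ v → ∀ x → Ed u v x x ≡ 0
Ed-loopless {u = u} {v} ne x with δ x u in p | δ x v in q
... | false | false = refl
... | false | true  = refl
... | true  | false = refl
... | true  | true  = ⊥-elim (ne (trans (sym (δ⇒≡ x u p)) (δ⇒≡ x v q)))

Ed-self : ∀ {n} (u v : Fin n) → 1 ≤ Ed u v u v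
Ed-self u v rewrite δ-refl u | δ-refl v = s≤s z≤n

Ed-off : ∀ {n} {u v x y : Fin n} → ¬ (x ≡ u × y ≡ v) → ¬ (x ≡ v × y ≡ u) → Ed u v x y ≡ 0
Ed-off {u = u} {v} {x} {y} p q = cong₂ _+_ (z x u y v p) (z x v y u q)
  where
  z : ∀ x u y v → ¬ (x ≡ u × y ≡ v) → (δ x u ∧ δ y v) ▸ 1 ≡ 0
  z x u y v p with δ x u in e | δ y v in f
  ... | false | _     = refl
  ... | true  | false = refl
  ... | true  | true  = ⊥-elim (p (δ⇒≡ x u e , δ⇒≡ y v f))

Ed-≤ : ∀ {n} (m : Multi n) → Symm m → ∀ {u v} → u ≢ v → 0 < m u v → ∀ x y → Ed u v x y ≤ m x y
Ed-≤ m s {u} {v} ne pos x y with δ x u in p | δ y v in q | δ x v in r | δ y u in t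
... | true  | true  | true  | _     = ⊥-elim (ne (trans (sym (δ⇒≡ x u p)) (δ⇒≡ x v r)))
... | true  | true  | false | _     rewrite δ⇒≡ x u p | δ⇒≡ y v q = pos
... | true  | false | true  | true  rewrite δ⇒≡ x v r | δ⇒≡ y u t = subst (0 <_) (s u v) pos
... | true  | false | true  | false = z≤n
... | true  | false | false | _     = z≤n
... | false | _     | true  | true  rewrite δ⇒≡ x v r | δ⇒≡ y u t = subst (0 <_) (s u v) pos
... | false | _     | true  | false = z≤n
... | false | _     | false | _     = z≤n

D-Ed : ∀ {n} (u v : Fin n) X → D (Ed u v) X ≡ 2 * ((X u ∧ X v) ▸ 1)
D-Ed u v X = begin
  D (Ed u v) X
    ≡⟨ D-+ (λ x y → (δ x u ∧ δ y v) ▸ 1) (λ x y → (δ x v ∧ δ y u) ▸ 1) X ⟩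
  _ ≡⟨ cong₂ _+_ (half u v) (half v u) ⟩
  (X u ∧ X v) ▸ 1 + (X v ∧ X u) ▸ 1
    ≡⟨ double (X u) (X v) ⟩
  2 * ((X u ∧ X v) ▸ 1) ∎
  where
  open ≡-Reasoning
  pull : ∀ a b c d → (a ∧ b) ▸ ((c ∧ d) ▸ 1) ≡ c ▸ (d ▸ ((a ∧ b) ▸ 1))
  pull a     b     false d     = ▸-zero (a ∧ b)
  pull false b     true  true  = refl
  pull false b     true  false = refl
  pull true  true  true  d     = refl
  pull true  false true  true  = refl
  pull true  false true  false = refl
  half : ∀ u v → D (λ x y → (δ x u ∧ δ y v) ▸ 1) X ≡ (X u ∧ X v) ▸ 1
  half u v = trans (∑-cong λ x → trans (∑-cong (λ y → pull (X x) (X y) (δ x u) (δ y v))) (∑-▸ (δ x u) (λ y → δ y v ▸ ((X x ∧ X y) ▸ 1))))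
    (trans (∑-δ u (λ x → ∑ (λ y → δ y v ▸ ((X x ∧ X y) ▸ 1)))) (∑-δ v (λ y → (X u ∧ X y) ▸ 1)))
  double : ∀ a b → (a ∧ b) ▸ 1 + (b ∧ a) ▸ 1 ≡ 2 * ((a ∧ b) ▸ 1)
  double true  true  = refl
  double true  false = refl
  double false true  = refl
  double false false = refl

deg-Ed : ∀ {n} (u v x : Fin n) → deg (Ed u v) x ≡ δ x u ▸ 1 + δ x v ▸ 1
deg-Ed u v x = trans (∑-+ (λ y → (δ x u ∧ δ y v) ▸ 1) (λ y → (δ x v ∧ δ y u) ▸ 1)) (cong₂ _+_ (half u v) (half v u))
  where
  half : ∀ u v → ∑ (λ y → (δ x u ∧ δ y v) ▸ 1) ≡ δ x u ▸ 1
  half u v = trans (∑-cong (λ y → pt (δ x u) (δ y v))) (trans (∑-▸ (δ x u) (λ y → δ y v ▸ 1)) (cong (δ x u ▸_) (∑-δ v (λ _ → 1))))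
    where
    pt : ∀ a b → (a ∧ b) ▸ 1 ≡ a ▸ (b ▸ 1)
    pt true  b = refl
    pt false b = refl

-- Sparse graphs and tight sets

-- A graph is sparse when every nonempty X spans at most 2|X| − 2 edges
-- (twice that, in terms of D), and X is tight when equality holds: the
-- independent sets and the spanned sets of the union of two graphic matroids.
Sparse : ∀ {n} → Multi n → Set
Sparse m = ∀ X u → X u ≡ true → D m X + 4 ≤ 4 * size X

Tight : ∀ {n} → Multi n → Sub n → Set
Tight m X = D m X + 4 ≡ 4 * size X

TightOn : ∀ {n} → Multi n → Sub n → Fin n → Fin n → Sub n → Set
TightOn m U u v Z = Tight m Z × Z ⊆ U × Z u ≡ true × Z v ≡ true

-- The search runs over bit vectors, and converting a set to a vector and back returns it only up to
-- pointwise equality; hence the requirement that `P` respects pointwise equality.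
anySub? : ∀ {n} {P : Sub n → Set} → (∀ X → Dec (P X)) →
  (∀ {X Y} → (∀ x → X x ≡ Y x) → P X → P Y) → Dec (∃ P)
anySub? {P = P} P? resp = map′ (λ (s , p) → lookup s , p)
  (λ (X , p) → tabulate X , resp (λ x → sym (lookup∘tabulate X x)) p)
  (anySubset? (λ s → P? (lookup s)))

_⊆?_ : ∀ {n} (X Y : Sub n) → Dec (X ⊆ Y)
X ⊆? Y = all? λ x → (X x Bool.≟ true) →-dec (Y x Bool.≟ true)

tightOn? : ∀ {n} (m : Multi n) U u v Z → Dec (TightOn m U u v Z)
tightOn? m U u v Z = (D m Z + 4 ≟ℕ 4 * size Z) ×-dec (Z ⊆? U) ×-dec (Z u Bool.≟ true) ×-dec (Z v Bool.≟ true)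

tightOn-resp : ∀ {n} (m : Multi n) U u v {X Y} → (∀ x → X x ≡ Y x) → TightOn m U u v X → TightOn m U u v Y
tightOn-resp m U u v e (t , s , p , q) =
  trans (cong (_+ 4) (D-cong {m = m} (λ _ _ → refl) (λ x → sym (e x)))) (trans t (cong (4 *_) (size-cong e))) ,
  (λ x y → s x (trans (e x) y)) , trans (sym (e u)) p , trans (sym (e v)) q

anyTight? : ∀ {n} (m : Multi n) U u v → Dec (∃ (TightOn m U u v))
anyTight? m U u v = anySub? (tightOn? m U u v) (tightOn-resp m U u v)

minimise : ∀ {A : Set} {P : A → Set} (f : A → ℕ) → (∀ k → Dec (∃ λ a → P a × f a < k)) →
  ∃ P → ∃ λ a → P a × ∀ b → P b → f a ≤ f b
minimise {A} {P} f search (a₀ , p₀) = go (f a₀) a₀ p₀ ≤-refl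
  where
  go : ∀ k a → P a → f a ≤ k → ∃ λ a → P a × ∀ b → P b → f a ≤ f b
  go k a p le with search (f a)
  ... | no none = a , p , λ b q → ≮⇒≥ (λ lt → none (b , q , lt))
  go zero    a p le | yes (b , q , lt) = ⊥-elim (n≮0 (≤-trans lt le))
  go (suc k) a p le | yes (b , q , lt) = go k b q (≤-pred (≤-trans lt le))

-- Uncrossing: sparsity of union and intersection, against the inequality for `D`, leaves room only
-- for equality in both. The common vertex `u` makes the intersection nonempty, so that sparsity
-- applies to it.
tight-∪∩ : ∀ {n} {m : Multi n} → Sparse m → ∀ {X Y} u → X u ≡ true → Y u ≡ true →
  Tight m X → Tight m Y → Tight m (X ∪ Y) × Tight m (X ∩ Y)
tight-∪∩ {m = m} sp {X} {Y} u p q tX tY =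
  arith (D m X) (D m Y) (D m (X ∪ Y)) (D m (X ∩ Y)) (size (X ∪ Y)) (size (X ∩ Y)) (size X) (size Y) (D-submodular m X Y) s∪ s∩ (size-∪∩ X Y) tX tY ,
  arith (D m X) (D m Y) (D m (X ∩ Y)) (D m (X ∪ Y)) (size (X ∩ Y)) (size (X ∪ Y)) (size X) (size Y) (≤-trans (D-submodular m X Y) (≤-reflexive (+-comm (D m (X ∪ Y)) _))) s∩ s∪
    (trans (+-comm (size (X ∩ Y)) _) (size-∪∩ X Y)) tX tY
  where
  s∪ = sp (X ∪ Y) u (∨-introˡ p)
  s∩ = sp (X ∩ Y) u (∧-intro p q)
  arith : ∀ a b c d p q r s → a + b ≤ c + d → c + 4 ≤ 4 * p → d + 4 ≤ 4 * q → p + q ≡ r + s →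
    a + 4 ≡ 4 * r → b + 4 ≡ 4 * s → c + 4 ≡ 4 * p
  arith a b c d p q r s h₁ h₂ h₃ h₄ h₅ h₆ = ≤-antisym h₂
    (lin 0 (+-mono-≤ h₁ (+-mono-≤ h₃ (+-mono-≤ (scale 4 (≤-reflexive h₄))
      (+-mono-≤ (≤-reflexive (sym h₅)) (≤-reflexive (sym h₆))))))
      (solve (a ∷ b ∷ c ∷ d ∷ p ∷ q ∷ r ∷ s ∷ [])))

sparse-mono : ∀ {n} {m m′ : Multi n} → (∀ x y → m x y ≤ m′ x y) → Sparse m′ → Sparse m
sparse-mono le sp X u p = ≤-trans (+-monoˡ-≤ 4 (D-mono {X = X} le (λ _ q → q))) (sp X u p)

tight-mono : ∀ {n} {m m′ : Multi n} → (∀ x y → m x y ≤ m′ x y) → Sparse m′ →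
  ∀ {X} u → X u ≡ true → Tight m X → Tight m′ X
tight-mono le sp {X} u p t = ≤-antisym (sp X u p) (≤-trans (≤-reflexive (sym t)) (+-monoˡ-≤ 4 (D-mono {X = X} le (λ _ q → q))))

tight-single : ∀ {n} (m : Multi n) u → m u u ≡ 0 → Tight m (single u)
tight-single m u e = trans (cong (_+ 4) (D-single m u e)) (cong (4 *_) (sym (size-single u)))

Loopless : ∀ {n} → Multi n → Set
Loopless m = ∀ x → m x x ≡ 0

D-even : ∀ {n} (m : Multi n) → Symm m → Loopless m → ∀ X → ∃ λ e → D m X ≡ 2 * e
D-even m s l X = ∑²-even (m ↾ X)
  (λ x y → cong₂ _▸_ (Bool.∧-comm (X x) (X y)) (s x y))
  (λ x → trans (cong ((X x ∧ X x) ▸_) (l x)) (▸-zero (X x ∧ X x)))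

-- Only sets containing both ends gain, namely 2. They have room for it: `D` is even, so the slack
-- of a set that is not tight cannot be 1.
sparse-add : ∀ {n} {m : Multi n} {u v} → Symm m → Loopless m → Sparse m →
  (∀ Y → Y u ≡ true → Y v ≡ true → ¬ Tight m Y) → Sparse (λ x y → m x y + Ed u v x y)
sparse-add {m = m} {u} {v} sy ll sp none X w p
  rewrite D-+ m (Ed u v) X | D-Ed u v X with X u in Xu | X v in Xv
... | false | _     = subst (λ k → k + 4 ≤ 4 * size X) (sym (+-identityʳ (D m X))) (sp X w p)
... | true  | false = subst (λ k → k + 4 ≤ 4 * size X) (sym (+-identityʳ (D m X))) (sp X w p)
... | true  | true  with D-even m sy ll X
...   | e , eq = arith (D m X) e (size X) eq (sp X w p) (none X Xu Xv)
  where
  arith : ∀ d e s → d ≡ 2 * e → d + 4 ≤ 4 * s → ¬ (d + 4 ≡ 4 * s) → d + 2 + 4 ≤ 4 * s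
  arith d e s refl h ne = lin 0 (scale 2 half) (solve (e ∷ s ∷ []))
    where
    half : e + 3 ≤ 2 * s
    half = ≤-trans (≤-reflexive (+-suc e 2)) (*-cancelˡ-< 2 (e + 2) (2 * s) (lin 0 (≤∧≢⇒< h ne) (solve (e ∷ s ∷ []))))

-- Tight sets through `u` and `v` are closed under intersection, so one of minimum size lies in all
-- others.
leastTight : ∀ {n} {m : Multi n} → Sparse m → ∀ u v → ∃ (TightOn m full u v) →
  ∃ λ Z → TightOn m full u v Z × ∀ Y → Y u ≡ true → Y v ≡ true → Tight m Y → Z ⊆ Y
leastTight {m = m} sp u v ex with minimise size
  (λ k → anySub? (λ X → tightOn? m full u v X ×-dec (size X <? k))
    (λ e (t , lt) → tightOn-resp m full u v e t , subst (_< k) (size-cong e) lt)) ex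
... | Z , on@(t , _ , Zu , Zv) , least = Z , on , sub
  where
  sub : ∀ Y → Y u ≡ true → Y v ≡ true → Tight m Y → Z ⊆ Y
  sub Y Yu Yv tY x Zx with bool (Y x)
  ... | inj₁ Yx = Yx
  ... | inj₂ ¬Yx = ⊥-elim (<⇒≱ (size-⊂ {X = Z ∩ Y} {Y = Z} (λ y q → proj₁ (∧-true q)) x Zx (cong₂ _∧_ Zx ¬Yx))
    (least (Z ∩ Y) (proj₂ (tight-∪∩ sp u Zu Yu t tY) , (λ _ _ → refl) , ∧-intro Zu Yu , ∧-intro Zv Yv)))

-- Tight sets through `u` are closed under union. As `u` varies, these greatest sets become the
-- classes of a partition of `U`.
greatestTight : ∀ {n} {m : Multi n} → Sparse m → ∀ U u → ∃ (TightOn m U u u) →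
  ∃ λ Z → TightOn m U u u Z × ∀ Y → TightOn m U u u Y → Y ⊆ Z
greatestTight {m = m} sp U u ex with minimise cosize
  (λ k → anySub? (λ X → tightOn? m U u u X ×-dec (cosize X <? k))
    (λ e (t , lt) → tightOn-resp m U u u e t , subst (_< k) (size-cong (λ x → cong not (e x))) lt)) ex
... | Z , on@(t , Z⊆U , Zu , _) , greatest = Z , on , sub
  where
  sub : ∀ Y → TightOn m U u u Y → Y ⊆ Z
  sub Y (tY , Y⊆U , Yu , _) x Yx with bool (Z x)
  ... | inj₁ Zx = Zx
  ... | inj₂ ¬Zx = ⊥-elim (<⇒≱
    (size-⊂ {X = λ y → not ((Z ∪ Y) y)} {Y = λ y → not (Z y)} (λ y q → co (Z y) (Y y) q) x
      (not-false ¬Zx) (cong not (∨-introʳ Yx)))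
    (greatest (Z ∪ Y) (proj₁ (tight-∪∩ sp u Zu Yu t tY) , into , ∨-introˡ Zu , ∨-introˡ Zu)))
    where
    co : ∀ a b → not (a ∨ b) ≡ true → not a ≡ true
    co false b _ = refl
    into : (Z ∪ Y) ⊆ U
    into y q with ∨-true {Z y} q
    ... | inj₁ z = Z⊆U y z
    ... | inj₂ z = Y⊆U y z

-- Components

first : ∀ {n} → Sub n → Maybe (Fin n)
first {zero}  X = nothing
first {suc n} X = if X Fin.zero then just Fin.zero else Maybe.map Fin.suc (first (λ x → X (Fin.suc x)))

first-cong : ∀ {n} {X Y : Sub n} → (∀ x → X x ≡ Y x) → first X ≡ first Y
first-cong {zero}  e = refl
first-cong {suc n} e = cong₂ (λ b r → if b then just Fin.zero else Maybe.map Fin.suc r) (e Fin.zero) (first-cong (λ x → e (Fin.suc x)))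

first-just : ∀ {n} (X : Sub n) u → X u ≡ true → ∃ λ w → first X ≡ just w × X w ≡ true
first-just {suc n} X u p with X Fin.zero in eq
first-just {suc n} X u            p | true  = Fin.zero , refl , eq
first-just {suc n} X Fin.zero     p | false = true≢false p eq
first-just {suc n} X (Fin.suc u)  p | false with first-just (λ x → X (Fin.suc x)) u p
... | w , e , q = Fin.suc w , cong (Maybe.map Fin.suc) e , q

-- The default d is only reached when X is empty.
rep : ∀ {n} → Sub n → Fin n → Fin n
rep X d = fromMaybe d (first X)

rep-∈ : ∀ {n} (X : Sub n) d u → X u ≡ true → X (rep X d) ≡ true
rep-∈ X d u p with first X | first-just X u p
... | _ | w , refl , q = q

rep-cong : ∀ {n} {X Y : Sub n} d e u → X u ≡ true → (∀ x → X x ≡ Y x) → rep X d ≡ rep Y e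
rep-cong {X = X} {Y} d e u p X≗Y with first X | first Y | first-cong X≗Y | first-just X u p
... | _ | _ | refl | w , refl , q = refl

-- Turns a partition of `U`, given by the class `Z u` of each vertex, into a labelling. The first
-- element of a class serves as its label, since it depends on the class only up to pointwise
-- equality.
module Classes {n} (U : Sub n) (Z : Fin n → Sub n)
  (Z⊆U : ∀ {u} → U u ≡ true → Z u ⊆ U)
  (Z-refl : ∀ {u} → U u ≡ true → Z u u ≡ true)
  (Z-eq : ∀ {u v} → U u ≡ true → Z u v ≡ true → ∀ x → Z u x ≡ Z v x) where

  class : Fin n → Fin n
  class u = rep (Z u) u

  same-class : ∀ {u v} → U u ≡ true → Z u v ≡ true → class u ≡ class v
  same-class {u} {v} p q = rep-cong u v u (Z-refl p) (Z-eq p q)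

  class-same : ∀ {u v} → U u ≡ true → U v ≡ true → class u ≡ class v → Z u v ≡ true
  class-same {u} {v} p q e = trans (Z-eq p ru v) (trans (sym (Z-eq q rv v)) (Z-refl q))
    where
    ru : Z u (class u) ≡ true
    ru = rep-∈ (Z u) u u (Z-refl p)
    rv : Z v (class u) ≡ true
    rv = subst (λ w → Z v w ≡ true) (sym e) (rep-∈ (Z v) v v (Z-refl q))

compress : ∀ {n} N (ℓ : Fin n → Fin N) → ∃ λ c → Σ (Fin n → Fin c) λ label →
  (∀ k → ∃ λ v → label v ≡ k) × (∀ u v → (label u ≡ label v → ℓ u ≡ ℓ v) × (ℓ u ≡ ℓ v → label u ≡ label v))
compress zero ℓ = zero , ℓ , (λ ()) , λ _ _ → (λ e → e) , (λ e → e)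
compress {n} (suc N) ℓ with all? (λ k → any? (λ v → ℓ v ≟ k))
... | yes onto = suc N , ℓ , onto , λ _ _ → (λ e → e) , (λ e → e)
... | no ¬onto with ¬∀⟶∃¬ (suc N) (λ k → ∃ λ v → ℓ v ≡ k) (λ k → any? (λ v → ℓ v ≟ k)) ¬onto
...   | k , unused = reindex (compress N ℓ′)
  where
  avoids : ∀ v → k ≢ ℓ v
  avoids v e = unused (v , sym e)
  ℓ′ : Fin n → Fin N
  ℓ′ v = punchOut (avoids v)
  reindex : _ → _
  reindex (c , label , onto , eq) = c , label , onto , λ u v →
    (λ e → punchOut-injective (avoids u) (avoids v) (proj₁ (eq u v) e)) ,
    (λ e → proj₂ (eq u v) (punchOut-cong k e))

used? : ∀ {n N} (U : Sub n) (ℓ : Fin n → Fin N) k → Dec (∃ λ v → U v ≡ true × ℓ v ≡ k)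
used? U ℓ k = any? λ v → (U v Bool.≟ true) ×-dec (ℓ v ≟ k)

used : ∀ {n N} → Sub n → (Fin n → Fin N) → Sub N
used U ℓ k = does (used? U ℓ k)

labels : ∀ {n N} → Sub n → (Fin n → Fin N) → ℕ
labels U ℓ = size (used U ℓ)

outside : ∀ {n} → Sub n → Subset n
outside U = tabulate (λ x → not (U x))

∉outside⇒ : ∀ {n} {U : Sub n} {v} → v ∉ outside U → U v ≡ true
∉outside⇒ {U = U} {v} ∉S with bool (U v)
... | inj₁ p = p
... | inj₂ p = ⊥-elim (∉S (lookup⇒[]= v _ (trans (lookup∘tabulate _ v) (not-false p))))

⇒∉outside : ∀ {n} {U : Sub n} {v} → U v ≡ true → v ∉ outside U
⇒∉outside {U = U} {v} p ∈S = true≢false p (not-true (trans (sym (lookup∘tabulate _ v)) ([]=⇒lookup ∈S)))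

∣outside∣ : ∀ {n} (U : Sub n) → ∣ outside U ∣ ≡ cosize U
∣outside∣ {zero}  U = refl
∣outside∣ {suc n} U with U Fin.zero
... | true  = ∣outside∣ (λ x → U (Fin.suc x))
... | false = cong suc (∣outside∣ (λ x → U (Fin.suc x)))

reach-start : ∀ {n} {m : Multi n} {S u v} → Reach m S u v → u ∉ S
reach-start (here p)       = p
reach-start (step p _ _ _) = p

reach-trans : ∀ {n} {m : Multi n} {S u v w} → Reach m S u v → Reach m S v w → Reach m S u w
reach-trans (here _)       s = s
reach-trans (step p q e r) s = step p q e (reach-trans r s)

reach-sym : ∀ {n} {m : Multi n} {S u v} → Symm m → Reach m S u v → Reach m S v u
reach-sym s (here p)                   = here p
reach-sym s (step {u} {w} p q e r) = reach-trans (reach-sym s r) (step q p (subst (0 <_) (s u w) e) (here p))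

reach-invariant : ∀ {n} {m : Multi n} {S u v} (P : Fin n → Set) →
  (∀ x y → x ∉ S → y ∉ S → 0 < m x y → P x → P y) → Reach m S u v → P u → P v
reach-invariant P inv (here _)       p = p
reach-invariant P inv (step a b e r) p = reach-invariant P inv r (inv _ _ a b e p)

Component : ∀ {n} → Multi n → Sub n → Fin n → Sub n → Set
Component m U u Z = Z u ≡ true × (∀ z → Z z ≡ true → Reach m (outside U) u z) ×
  (∀ z w → Z z ≡ true → U w ≡ true → 0 < m z w → Z w ≡ true)

component : ∀ {n} (m : Multi n) U u → U u ≡ true → ∃ (Component m U u)
component {n} m U u Uu = grow (cosize (single u)) (single u) ≤-refl (δ-refl u)
  (λ z p → subst (Reach m (outside U) u) (sym (δ⇒≡ z u p)) (here (⇒∉outside Uu)))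
  where
  grow : ∀ k Z → cosize Z ≤ k → Z u ≡ true → (∀ z → Z z ≡ true → Reach m (outside U) u z) → ∃ (Component m U u)
  grow k Z le Zu reach with any? (λ w → (Z w Bool.≟ false) ×-dec (U w Bool.≟ true) ×-dec any? (λ z → (Z z Bool.≟ true) ×-dec (0 <? m z w)))
  ... | no closed = Z , Zu , reach , cl
    where
    cl : ∀ z w → Z z ≡ true → U w ≡ true → 0 < m z w → Z w ≡ true
    cl z w Zz Uw e with bool (Z w)
    ... | inj₁ p = p
    ... | inj₂ p = ⊥-elim (closed (w , p , Uw , z , Zz , e))
  ... | yes (w , ¬Zw , Uw , z , Zz , e) with k
  ...   | zero   = ⊥-elim (n≮0 (≤-trans (size-pos (λ x → not (Z x)) w (not-false ¬Zw)) le))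
  ...   | suc k′ = grow k′ (Z ∪ single w) (≤-pred (≤-trans smaller le)) (∨-introˡ Zu) reach′
    where
    smaller : cosize (Z ∪ single w) < cosize Z
    smaller = size-⊂ {X = λ x → not ((Z ∪ single w) x)} {Y = λ x → not (Z x)} (λ x → co (Z x)) w (not-false ¬Zw)
      (cong not (∨-introʳ (δ-refl w)))
      where
      co : ∀ a {b} → not (a ∨ b) ≡ true → not a ≡ true
      co false _ = refl
    reach′ : ∀ x → (Z ∪ single w) x ≡ true → Reach m (outside U) u x
    reach′ x p with ∨-true {Z x} p
    ... | inj₁ q = reach x q
    ... | inj₂ q rewrite δ⇒≡ x w q = reach-trans (reach z Zz)
      (step (reach-start (reach-end (reach z Zz))) (⇒∉outside Uw) e (here (⇒∉outside Uw)))
      where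
      reach-end : ∀ {v x} → Reach m (outside U) v x → Reach m (outside U) x x
      reach-end (here p)       = here p
      reach-end (step _ _ _ r) = reach-end r

components : ∀ {n} (G : Graph n) U u₀ → U u₀ ≡ true → ∃ (HasComponents G (outside U))
components {n} G U u₀ Uu₀ = build (compress n (λ v → class (home v)))
  where
  m = mult G
  Zs : ∀ u → ∃ λ Z → U u ≡ true → Component m U u Z
  Zs u with U u Bool.≟ true
  ... | yes p = proj₁ (component m U u p) , λ _ → proj₂ (component m U u p)
  ... | no ¬p = single u , λ p → ⊥-elim (¬p p)
  Z : Fin n → Sub n
  Z u = proj₁ (Zs u)
  Z⇒reach : ∀ {u} → U u ≡ true → ∀ z → Z u z ≡ true → Reach m (outside U) u z
  Z⇒reach p = proj₁ (proj₂ (proj₂ (Zs _) p))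
  reach⇒Z : ∀ {u} → U u ≡ true → ∀ z → Reach m (outside U) u z → Z u z ≡ true
  reach⇒Z {u} p z r = reach-invariant (λ x → Z u x ≡ true)
    (λ x y _ y∉ e q → proj₂ (proj₂ (proj₂ (Zs u) p)) x y q (∉outside⇒ y∉) e) r (proj₁ (proj₂ (Zs u) p))
  Z⊆U : ∀ {u} → U u ≡ true → Z u ⊆ U
  Z⊆U p z q = ∉outside⇒ (reach-start (reach-sym (symmetric G) (Z⇒reach p z q)))
  Z-eq : ∀ {u v} → U u ≡ true → Z u v ≡ true → ∀ x → Z u x ≡ Z v x
  Z-eq {u} {v} p q x = ⇔-bool
    (λ a → reach⇒Z Uv x (reach-trans (reach-sym (symmetric G) (Z⇒reach p v q)) (Z⇒reach p x a)))
    (λ a → reach⇒Z p x (reach-trans (Z⇒reach p v q) (Z⇒reach Uv x a)))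
    where Uv = Z⊆U p v q
  open Classes U Z Z⊆U (λ {u} p → proj₁ (proj₂ (Zs u) p)) Z-eq
  -- The labelling is total, so a vertex outside `U` borrows the label of `u₀`; every label that
  -- occurs is then attained inside `U`.
  home : Fin n → Fin n
  home v = if U v then v else u₀
  home-∈ : ∀ v → U (home v) ≡ true
  home-∈ v with U v in eq
  ... | true  = eq
  ... | false = Uu₀
  home-id : ∀ v → U v ≡ true → home v ≡ v
  home-id v p rewrite p = refl
  build : _ → _
  build (c , label , onto , eq) = c , label , onto′ , λ u v u∉ v∉ → mk⇔ (to u v u∉ v∉) (from u v u∉ v∉)
    where
    onto′ : ∀ k → ∃ λ v → v ∉ outside U × label v ≡ k
    onto′ k with onto k
    ... | v , e = home v , ⇒∉outside (home-∈ v) , trans (proj₂ (eq (home v) v) (cong class (home-id (home v) (home-∈ v)))) e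
    to : ∀ u v → u ∉ outside U → v ∉ outside U → label u ≡ label v → Reach m (outside U) u v
    to u v u∉ v∉ e = Z⇒reach Uu v (class-same Uu Uv
      (trans (sym (cong class (home-id u Uu))) (trans (proj₁ (eq u v) e) (cong class (home-id v Uv)))))
      where
      Uu = ∉outside⇒ u∉
      Uv = ∉outside⇒ v∉
    from : ∀ u v → u ∉ outside U → v ∉ outside U → Reach m (outside U) u v → label u ≡ label v
    from u v u∉ v∉ r = proj₂ (eq u v) (trans (cong class (home-id u Uu))
      (trans (same-class Uu (reach⇒Z Uu v r)) (sym (cong class (home-id v (∉outside⇒ v∉))))))
      where Uu = ∉outside⇒ u∉

-- The hypothesis divided by 7 and freed of exact counts: with `U` the complement of the deleted
-- set, a labelling constant along the edges inside `U` bounds the number of components from below,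
-- and `I` bounds the number of isolated vertices.
Tough : ∀ {n} → Multi n → Set
Tough {n} g = ∀ U (ℓ : Fin n → Fin n) I →
  (∀ x y → U x ≡ true → U y ≡ true → ℓ x ≢ ℓ y → g x y ≡ 0) →
  I ⊆ U → (∀ x y → I x ≡ true → U y ≡ true → g x y ≡ 0) →
  2 * labels U ℓ + 3 * size I ≤ cosize U + 2

tough : ∀ {n} (G : Graph n) →
  (∀ S c → HasComponents G S c → 14 * c + 21 * iso G S ≤ 7 * ∣ S ∣ + 14) → Tough (mult G)
tough {n} G hyp U ℓ I cut I⊆U isolated with any? (λ u → U u Bool.≟ true)
... | no empty = subst₂ (λ a b → 2 * a + 3 * b ≤ cosize U + 2) (sym no-labels) (sym no-I) z≤n
  where
  no-labels : labels U ℓ ≡ 0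
  no-labels = ∑-zero λ k → cong (_▸ 1) (dec-false (used? U ℓ k) (λ (v , p , _) → empty (v , p)))
  no-I : size I ≡ 0
  no-I = ∑-zero λ x → cong (_▸ 1) (out x)
    where
    out : ∀ x → I x ≡ false
    out x with bool (I x)
    ... | inj₁ p = ⊥-elim (empty (x , I⊆U x p))
    ... | inj₂ p = p
... | yes (u₀ , p₀) with components G U u₀ p₀
...   | c , hc@(label , _ , eq) =
  arith (labels U ℓ) (size I) c (iso G (outside U)) (cosize U) labels≤c I≤iso
    (subst (λ k → 14 * c + 21 * iso G (outside U) ≤ 7 * k + 14) (∣outside∣ U) (hyp (outside U) c hc))
  where
  arith : ∀ l i c j s → l ≤ c → i ≤ j → 14 * c + 21 * j ≤ 7 * s + 14 → 2 * l + 3 * i ≤ s + 2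
  arith l i c j s h₁ h₂ h₃ = *-cancelˡ-≤ 7 (lin 0 (+-mono-≤ (scale 14 h₁) (+-mono-≤ (scale 21 h₂) h₃))
    (solve (l ∷ i ∷ c ∷ j ∷ s ∷ [])))
  witness : ∀ k → Fin n
  witness k with used? U ℓ k
  ... | yes (v , _) = v
  ... | no _        = u₀
  witness-∈ : ∀ k → used U ℓ k ≡ true → U (witness k) ≡ true × ℓ (witness k) ≡ k
  witness-∈ k p with used? U ℓ k
  ... | yes (v , q) = q
  labels≤c : labels U ℓ ≤ c
  -- A path inside `U` never changes `ℓ`, so vertices with different labels lie in different
  -- components.
  labels≤c = ∑-injective (used U ℓ) (λ k → label (witness k)) λ k k′ p q e →
    trans (sym (proj₂ (witness-∈ k p))) (trans
      (reach-invariant (λ x → ℓ (witness k) ≡ ℓ x) stay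
        (Equivalence.to (eq _ _ (⇒∉outside (proj₁ (witness-∈ k p))) (⇒∉outside (proj₁ (witness-∈ k′ q)))) e) refl)
      (proj₂ (witness-∈ k′ q)))
    where
    stay : ∀ {a} x y → x ∉ outside U → y ∉ outside U → 0 < mult G x y → a ≡ ℓ x → a ≡ ℓ y
    stay x y x∉ y∉ e refl with ℓ x ≟ ℓ y
    ... | yes q = q
    ... | no ¬q = ⊥-elim (n≮0 (subst (0 <_) (cut x y (∉outside⇒ x∉) (∉outside⇒ y∉) ¬q) e))
  I≤iso : size I ≤ iso G (outside U)
  I≤iso = ∑-mono pt
    where
    pt : ∀ x → I x ▸ 1 ≤ (if lookup (outside U) x then 0 else (if isZero (degOutside (mult G) (outside U) x) then 1 else 0))
    none : ∀ x → I x ≡ true → ∀ y → (if lookup (outside U) y then 0 else mult G x y) ≡ 0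
    none x Ix y rewrite lookup∘tabulate (λ x → not (U x)) y with U y in Uy
    ... | true  = isolated x y Ix Uy
    ... | false = refl
    pt x with I x in Ix
    ... | false = z≤n
    ... | true rewrite lookup∘tabulate (λ x → not (U x)) x | I⊆U x Ix | ∑-zero (none x Ix) = ≤-refl

-- Toughness bounds the number of classes of a partition

-- Greedy deletion of closed neighbourhoods of minimum-degree vertices: if v
-- has minimum degree d, then |N[v]| ≤ d + 1 and (6 − d)(d + 1) ≤ 12.
independentSet : ∀ {n} (g : Multi n) → Symm g → Loopless g → ∀ k Q → size Q ≤ k →
  ∃ λ I → I ⊆ Q × (∀ x y → I x ≡ true → I y ≡ true → g x y ≡ 0) × 6 * size Q ≤ 12 * size I + D g Q
independentSet {n} g sy ll k Q le with any? (λ v → Q v Bool.≟ true)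
... | no empty = Q , (λ _ p → p) , (λ x _ p → ⊥-elim (empty (x , p))) ,
  ≤-trans (*-monoˡ-≤ (size Q) (m≤m+n 6 6)) (m≤m+n _ _)
... | yes nonempty with minimise {P = λ v → Q v ≡ true} (λ v → ∑ (λ y → Q y ▸ g v y))
                         (λ k → any? (λ v → (Q v Bool.≟ true) ×-dec (_ <? k))) nonempty | k
...   | v , Qv , least | zero   = ⊥-elim (n≮0 (≤-trans (size-pos Q v Qv) le))
...   | v , Qv , least | suc k′ = extend (independentSet g sy ll k′ Q′ (≤-pred (≤-trans Q′<Q le)))
  where
  d = ∑ (λ y → Q y ▸ g v y)
  near : Sub n
  near x = δ x v ∨ does (0 <? g v x)
  N Q′ : Sub n
  N x  = Q x ∧ near x
  Q′ x = Q x ∧ not (near x)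
  Q′<Q : size Q′ < size Q
  Q′<Q = size-⊂ {X = Q′} {Y = Q} (λ x p → proj₁ (∧-true p)) v Qv (cong₂ (λ a b → a ∧ not b) Qv (∨-introˡ (δ-refl v)))
  split : size Q ≡ size Q′ + size N
  split = trans (∑-cong (λ x → pt (Q x) (near x))) (∑-+ (λ x → Q′ x ▸ 1) (λ x → N x ▸ 1))
    where
    pt : ∀ a b → a ▸ 1 ≡ (a ∧ not b) ▸ 1 + (a ∧ b) ▸ 1
    pt true  true  = refl
    pt true  false = refl
    pt false b     = refl
  N≤ : size N ≤ suc d
  N≤ = ≤-trans (∑-mono pt) (≤-reflexive (trans (∑-+ (λ x → δ x v ▸ 1) (λ x → Q x ▸ g v x)) (cong (_+ d) (size-single v))))
    where
    pt : ∀ x → N x ▸ 1 ≤ δ x v ▸ 1 + Q x ▸ g v x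
    pt x with Q x | δ x v
    ... | false | _     = z≤n
    ... | true  | true  = s≤s z≤n
    ... | true  | false = pos (g v x)
      where
      pos : ∀ k → does (0 <? k) ▸ 1 ≤ k
      pos zero    = z≤n
      pos (suc k) = s≤s z≤n
  -- Only the rows of the deleted vertices are charged; by the choice of `v` each of them is at
  -- least `d`.
  D-drop : D g Q′ + d * size N ≤ D g Q
  D-drop = begin
    D g Q′ + d * size N
      ≡⟨ cong₂ _+_ (D-rows g Q′) (sym (∑-* d (λ x → N x ▸ 1))) ⟩
    ∑ (λ x → Q′ x ▸ ∑ (λ y → Q′ y ▸ g x y)) + ∑ (λ x → d * (N x ▸ 1))
      ≡⟨ sym (∑-+ (λ x → Q′ x ▸ ∑ (λ y → Q′ y ▸ g x y)) (λ x → d * (N x ▸ 1))) ⟩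
    ∑ (λ x → Q′ x ▸ ∑ (λ y → Q′ y ▸ g x y) + d * (N x ▸ 1))
      ≤⟨ ∑-mono pt ⟩
    ∑ (λ x → Q x ▸ ∑ (λ y → Q y ▸ g x y))
      ≡⟨ sym (D-rows g Q) ⟩
    D g Q ∎
    where
    open ≤-Reasoning
    pt : ∀ x → Q′ x ▸ ∑ (λ y → Q′ y ▸ g x y) + d * (N x ▸ 1) ≤ Q x ▸ ∑ (λ y → Q y ▸ g x y)
    pt x with Q x in Qx | near x
    ... | false | _     = ≤-reflexive (*-zeroʳ d)
    ... | true  | true  = ≤-trans (≤-reflexive (*-identityʳ d)) (least x Qx)
    ... | true  | false = ≤-trans (≤-reflexive (trans (cong (∑ (λ y → Q′ y ▸ g x y) +_) (*-zeroʳ d)) (+-identityʳ _)))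
      (∑-mono (λ y → ▸-mono {Q′ y} {Q y} (λ p → proj₁ (∧-true p)) ≤-refl))
  bound : ∀ d {t} → t ≤ suc d → 6 * t ≤ 12 + d * t
  bound = go
    where
    small : ∀ e d {t} → e + d ≡ 6 → e * suc d ≤ 12 → t ≤ suc d → 6 * t ≤ 12 + d * t
    small e d {t} eq le t≤ = ≤-trans (≤-reflexive (trans (cong (_* t) (sym eq)) (*-distribʳ-+ t e d))) (+-monoˡ-≤ (d * t) (≤-trans (scale e t≤) le))
    go : ∀ d {t} → t ≤ suc d → 6 * t ≤ 12 + d * t
    go 0 = small 6 0 refl (m≤m+n 6 6)
    go 1 = small 5 1 refl (m≤m+n 10 2)
    go 2 = small 4 2 refl ≤-refl
    go 3 = small 3 3 refl ≤-refl
    go 4 = small 2 4 refl (m≤m+n 10 2)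
    go 5 = small 1 5 refl (m≤m+n 6 6)
    go (suc (suc (suc (suc (suc (suc d)))))) {t} _ = ≤-trans (*-monoˡ-≤ t (m≤m+n 6 d)) (m≤n+m _ 12)
  arith : ∀ s s′ t d D D′ i i′ → s ≡ s′ + t → t ≤ suc d → D′ + d * t ≤ D → 6 * s′ ≤ 12 * i′ + D′ → i′ + 1 ≤ i → 6 * s ≤ 12 * i + D
  arith s s′ t d D D′ i i′ h₁ h₂ h₃ h₄ h₅ =
    lin 0 (+-mono-≤ (scale 6 (≤-reflexive h₁)) (+-mono-≤ (bound d h₂) (+-mono-≤ h₃ (+-mono-≤ h₄ (scale 12 h₅)))))
      (identity s s′ t (d * t) D D′ i i′)
    where
    identity : ∀ s s′ t dt D D′ i i′ →
      6 * s + (6 * (s′ + t) + (12 + dt + (D + (12 * i′ + D′ + 12 * i)))) + 0 ≡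
      12 * i + D + (6 * s + (6 * t + (D′ + dt + (6 * s′ + 12 * (i′ + 1)))))
    identity = solve-∀
  extend : _ → ∃ λ I → I ⊆ Q × (∀ x y → I x ≡ true → I y ≡ true → g x y ≡ 0) × 6 * size Q ≤ 12 * size I + D g Q
  extend (I′ , I′⊆Q′ , indep , ineq) = I , I⊆Q , indep′ ,
    arith (size Q) (size Q′) (size N) d (D g Q) (D g Q′) (size I) (size I′) split N≤ D-drop ineq
      (≤-trans (≤-reflexive (+-comm (size I′) 1)) (size-⊂ {X = I′} {Y = I} (λ x → ∨-introˡ) v (∨-introʳ (δ-refl v)) v∉I′))
    where
    I = I′ ∪ single v
    v∉I′ : I′ v ≡ false
    v∉I′ with bool (I′ v)
    ... | inj₂ p = p
    ... | inj₁ p = true≢false (∨-introˡ (δ-refl v)) (not-true (proj₂ (∧-true (I′⊆Q′ v p))))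
    I⊆Q : I ⊆ Q
    I⊆Q x p with ∨-true {I′ x} p
    ... | inj₁ q = proj₁ (∧-true (I′⊆Q′ x q))
    ... | inj₂ q rewrite δ⇒≡ x v q = Qv
    far : ∀ x → I′ x ≡ true → g v x ≡ 0
    far x p with 0 <? g v x
    ... | no ¬pos = n≤0⇒n≡0 (≮⇒≥ ¬pos)
    ... | yes pos = true≢false (∨-introʳ {δ x v} (dec-true (0 <? g v x) pos)) (not-true (proj₂ (∧-true (I′⊆Q′ x p))))
    indep′ : ∀ x y → I x ≡ true → I y ≡ true → g x y ≡ 0
    indep′ x y p q with ∨-true {I′ x} p | ∨-true {I′ y} q
    ... | inj₁ p | inj₁ q = indep x y p q
    ... | inj₁ p | inj₂ q rewrite δ⇒≡ y v q = trans (sy x v) (far x p)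
    ... | inj₂ p | inj₁ q rewrite δ⇒≡ x v p = far y q
    ... | inj₂ p | inj₂ q rewrite δ⇒≡ x v p | δ⇒≡ y v q = ll v

cut : ∀ {n N} → Multi n → (Fin n → Fin N) → Multi n
cut g ℓ x y = not (δ (ℓ x) (ℓ y)) ▸ g x y

δ-sym : ∀ {n} (x y : Fin n) → δ x y ≡ δ y x
δ-sym x y = ⇔-bool (λ p → trans (cong (δ y) (δ⇒≡ x y p)) (δ-refl y)) (λ p → trans (cong (δ x) (δ⇒≡ y x p)) (δ-refl x))

cut-sym : ∀ {n N} {g : Multi n} (ℓ : Fin n → Fin N) → Symm g → Symm (cut g ℓ)
cut-sym ℓ s x y = cong₂ (λ a k → not a ▸ k) (δ-sym (ℓ x) (ℓ y)) (s x y)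

↾-sym : ∀ {n} {m : Multi n} X → Symm m → Symm (m ↾ X)
↾-sym X s x y = cong₂ _▸_ (Bool.∧-comm (X x) (X y)) (s x y)

-- A vertex that shares its class is moved out of U as long as it has an edge
-- to another class.  Then the one-vertex classes Q span all cut edges, and an
-- independent subset of Q is left as isolated vertices.
classes-bound : ∀ {n} (g : Multi n) → Symm g → Loopless g → Tough g → ∀ (ℓ : Fin n → Fin n) k U → size U ≤ k →
  4 * labels U ℓ ≤ D (cut g ℓ) U + 2 * cosize U + 4
classes-bound {n} g sy ll tg ℓ k U le
  with any? (λ v → (U v Bool.≟ true) ×-dec any? (λ w → (U w Bool.≟ true) ×-dec (¬? (w ≟ v)) ×-dec (ℓ w ≟ ℓ v))
               ×-dec any? (λ y → (U y Bool.≟ true) ×-dec (¬? (ℓ v ≟ ℓ y)) ×-dec (0 <? g v y))) | k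
... | yes (v , Uv , _ , _) | zero = ⊥-elim (n≮0 (≤-trans (size-pos U v Uv) le))
-- The bound for `U - v` implies the bound for `U`: the twin `w` keeps the label in use, the lost
-- edge vy takes at least 2 off `D`, and this pays for the increase of 2 in twice the cosize.
... | yes (v , Uv , (w , Uw , w≢v , ℓw≡ℓv) , (y , Uy , ℓv≢ℓy , vy)) | suc k′ =
  arith (labels U ℓ) (labels (U - v) ℓ) (D c (U - v)) (D c U) (cosize U) (cosize (U - v))
    (size-mono keeps) (classes-bound g sy ll tg ℓ k′ (U - v) smaller) drop (cosize-remove U v Uv)
  where
  c = cut g ℓ
  smaller : size (U - v) ≤ k′
  smaller = ≤-pred (≤-trans (≤-reflexive (trans (+-comm 1 _) (sym (size-remove U v Uv)))) le)
  keeps : used U ℓ ⊆ used (U - v) ℓ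
  keeps j p with does⇒ (used? U ℓ j) p
  ... | x , Ux , e with x ≟ v
  ...   | no x≢v   = dec-true (used? (U - v) ℓ j) (x , -intro {X = U} Ux x≢v , e)
  ...   | yes refl = dec-true (used? (U - v) ℓ j) (w , -intro {X = U} Uw w≢v , trans ℓw≡ℓv e)
  v≢y : v ≢ y
  v≢y e = ℓv≢ℓy (cong ℓ e)
  cut-pos : 0 < (c ↾ U) v y
  cut-pos rewrite Uv | Uy | δ-≢ ℓv≢ℓy = vy
  drop : D c (U - v) + 2 ≤ D c U
  drop = ≤-trans (≤-reflexive (trans (cong (D c (U - v) +_) (sym (D-Ed v y full))) (sym (∑²-+ (c ↾ (U - v)) (Ed v y))))) (∑²-mono pt)
    where
    out : (U - v) v ≡ false
    out = trans (cong (λ b → U v ∧ not b) (δ-refl v)) (Bool.∧-zeroʳ (U v))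
    edge : ∀ x z → Ed v y x z ≤ (c ↾ U) x z
    edge = Ed-≤ (c ↾ U) (↾-sym U (cut-sym ℓ sy)) v≢y cut-pos
    pt : ∀ x z → (c ↾ (U - v)) x z + Ed v y x z ≤ (c ↾ U) x z
    pt x z = at (x ≟ v) (z ≟ v)
      where
      at : Dec (x ≡ v) → Dec (z ≡ v) → (c ↾ (U - v)) x z + Ed v y x z ≤ (c ↾ U) x z
      at (yes refl) _ = subst (λ a → (a ∧ (U - x) z) ▸ c x z + Ed x y x z ≤ (c ↾ U) x z) (sym out) (edge x z)
      at (no _) (yes refl) = subst (λ a → a ▸ c x z + Ed z y x z ≤ (c ↾ U) x z)
        (sym (trans (cong ((U - z) x ∧_) out) (Bool.∧-zeroʳ _))) (edge x z)
      at (no p) (no q) = ≤-trans (≤-reflexive (trans (cong ((c ↾ (U - v)) x z +_) (Ed-off (λ r → p (proj₁ r)) (λ r → q (proj₂ r)))) (+-identityʳ _)))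
        (▸-mono {(U - v) x ∧ (U - v) z} {U x ∧ U z} (λ r → ∧-intro (proj₁ (∧-true {U x} (proj₁ (∧-true {(U - v) x} r)))) (proj₁ (∧-true {U z} (proj₂ (∧-true {(U - v) x} r))))) ≤-refl)
  arith : ∀ l l′ d′ d s s′ → l ≤ l′ → 4 * l′ ≤ d′ + 2 * s′ + 4 → d′ + 2 ≤ d → s′ ≡ s + 1 → 4 * l ≤ d + 2 * s + 4
  arith l l′ d′ d s .(s + 1) h₁ h₂ h₃ refl = lin 0 (+-mono-≤ (scale 4 h₁) (+-mono-≤ h₂ h₃)) (solve (l ∷ l′ ∷ d′ ∷ d ∷ s ∷ []))
... | no none | _ with independentSet g sy ll n Q (size≤n Q)
  where
  size≤n : ∀ X → size X ≤ n
  size≤n X = ≤-trans (m≤m+n (size X) (cosize X)) (≤-reflexive (size-cosize X))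
  Q : Sub n
  Q x = U x ∧ not (does (any? (λ w → (U w Bool.≟ true) ×-dec (¬? (w ≟ x)) ×-dec (ℓ w ≟ ℓ x))))
... | I , I⊆Q , indep , ineq =
  arith (labels U ℓ) (labels U′ ℓ) (size I) (cosize U) (cosize U′) (size Q) (D g Q) (D (cut g ℓ) U)
    (tg U′ ℓ I no-cut I⊆U′ isolated) labels-drop cosize-drop ineq (∑²-mono Q-cut)
  where
  Twin : Fin n → Set
  Twin x = ∃ λ w → U w ≡ true × w ≢ x × ℓ w ≡ ℓ x
  twin? : ∀ x → Dec (Twin x)
  twin? x = any? (λ w → (U w Bool.≟ true) ×-dec (¬? (w ≟ x)) ×-dec (ℓ w ≟ ℓ x))
  Q U′ : Sub n
  Q x  = U x ∧ not (does (twin? x))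
  -- Of the one-vertex classes only those in `I` stay. Vertices with a twin have no cut edges left,
  -- so every remaining label is a union of components.
  U′ x = U x ∧ (does (twin? x) ∨ I x)
  Q-solo : ∀ x → Q x ≡ true → ¬ Twin x
  Q-solo x p t = true≢false (dec-true (twin? x) t) (not-true (proj₂ (∧-true p)))
  I⊆U′ : I ⊆ U′
  I⊆U′ x p = ∧-intro (proj₁ (∧-true {U x} (I⊆Q x p))) (∨-introʳ p)
  U′⊆U : U′ ⊆ U
  U′⊆U x p = proj₁ (∧-true p)
  U′-cases : ∀ x → U′ x ≡ true → Twin x ⊎ I x ≡ true
  U′-cases x p with ∨-true {does (twin? x)} (proj₂ (∧-true {U x} p))
  ... | inj₁ t = inj₁ (does⇒ (twin? x) t)
  ... | inj₂ q = inj₂ q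
  twin-cut : ∀ x y → U x ≡ true → Twin x → U y ≡ true → ℓ x ≢ ℓ y → g x y ≡ 0
  twin-cut x y Ux t Uy ne = n≤0⇒n≡0 (≮⇒≥ λ pos → none (x , Ux , t , y , Uy , ne , pos))
  no-cut : ∀ x y → U′ x ≡ true → U′ y ≡ true → ℓ x ≢ ℓ y → g x y ≡ 0
  no-cut x y p q ne with U′-cases x p | U′-cases y q
  ... | inj₁ t | _      = twin-cut x y (U′⊆U x p) t (U′⊆U y q) ne
  ... | inj₂ _ | inj₁ t = trans (sy x y) (twin-cut y x (U′⊆U y q) t (U′⊆U x p) (λ e → ne (sym e)))
  ... | inj₂ a | inj₂ b = indep x y a b
  same-class-solo : ∀ x y → Q x ≡ true → U y ≡ true → ℓ x ≡ ℓ y → x ≡ y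
  same-class-solo x y p Uy e with y ≟ x
  ... | yes q = sym q
  ... | no ¬q = ⊥-elim (Q-solo x p (y , Uy , ¬q , sym e))
  isolated : ∀ x y → I x ≡ true → U′ y ≡ true → g x y ≡ 0
  isolated x y p q with ℓ x ≟ ℓ y
  ... | no ne = no-cut x y (I⊆U′ x p) q ne
  ... | yes e rewrite same-class-solo x y (I⊆Q x p) (U′⊆U y q) e = ll y
  Q-cut : ∀ x y → (g ↾ Q) x y ≤ (cut g ℓ ↾ U) x y
  Q-cut x y with Q x in Qx | Q y in Qy
  ... | false | _     = z≤n
  ... | true  | false = z≤n
  ... | true  | true rewrite proj₁ (∧-true {U x} Qx) | proj₁ (∧-true {U y} Qy) with ℓ x ≟ ℓ y
  ...   | no _  = ≤-refl
  ...   | yes e = ≤-reflexive (trans (cong (g x) (sym (same-class-solo x y Qx (proj₁ (∧-true {U y} Qy)) e))) (ll x))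
  Q∖I : Sub n
  Q∖I x = Q x ∧ not (I x)
  size-Q : size Q∖I + size I ≡ size Q
  size-Q = trans (sym (∑-+ (λ x → Q∖I x ▸ 1) (λ x → I x ▸ 1))) (∑-cong (λ x → pt (Q x) (I x) (I⊆Q x)))
    where
    pt : ∀ a b → (b ≡ true → a ≡ true) → (a ∧ not b) ▸ 1 + b ▸ 1 ≡ a ▸ 1
    pt true  true  _ = refl
    pt true  false _ = refl
    pt false false _ = refl
    pt false true  f = true≢false refl (sym (f refl))
  cosize-drop : cosize U′ + size I ≡ cosize U + size Q
  cosize-drop = trans (sym (∑-+ (λ x → not (U′ x) ▸ 1) (λ x → I x ▸ 1)))
    (trans (∑-cong (λ x → pt (U x) (does (twin? x)) (I x) (I⊆Q x))) (∑-+ (λ x → not (U x) ▸ 1) (λ x → Q x ▸ 1)))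
    where
    pt : ∀ u t i → (i ≡ true → u ∧ not t ≡ true) → not (u ∧ (t ∨ i)) ▸ 1 + i ▸ 1 ≡ not u ▸ 1 + (u ∧ not t) ▸ 1
    pt true  true  false _ = refl
    pt true  false true  _ = refl
    pt true  false false _ = refl
    pt false t     false _ = refl
    pt true  true  true  f = true≢false refl (sym (f refl))
    pt false t     true  f = true≢false refl (sym (f refl))
  labels-drop : labels U ℓ + size I ≤ labels U′ ℓ + size Q
  labels-drop = begin
    labels U ℓ + size I
      ≤⟨ +-monoˡ-≤ (size I) (∑-mono pt) ⟩
    ∑ (λ j → used U′ ℓ j ▸ 1 + lost j) + size I
      ≡⟨ cong (_+ size I) (∑-+ (λ j → used U′ ℓ j ▸ 1) lost) ⟩
    labels U′ ℓ + ∑ lost + size I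
      ≡⟨ cong (λ k → labels U′ ℓ + k + size I) (trans (∑-swap (λ j v → δ j (ℓ v) ▸ (Q∖I v ▸ 1))) (∑-cong (λ v → ∑-δ (ℓ v) (λ _ → Q∖I v ▸ 1)))) ⟩
    labels U′ ℓ + size Q∖I + size I
      ≡⟨ trans (+-assoc (labels U′ ℓ) _ _) (cong (labels U′ ℓ +_) size-Q) ⟩
    labels U′ ℓ + size Q ∎
    where
    open ≤-Reasoning
    lost : Fin n → ℕ
    lost j = ∑ (λ v → δ j (ℓ v) ▸ (Q∖I v ▸ 1))
    pt : ∀ j → used U ℓ j ▸ 1 ≤ used U′ ℓ j ▸ 1 + lost j
    pt j with used? U ℓ j
    ... | no _ = z≤n
    ... | yes (v , Uv , refl) with bool (U′ v)
    ...   | inj₁ p rewrite dec-true (used? U′ ℓ (ℓ v)) (v , p , refl) = s≤s z≤n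
    ...   | inj₂ p = ≤-trans (≤-trans (≤-reflexive own-term) (∑-elem (λ w → δ (ℓ v) (ℓ w) ▸ (Q∖I w ▸ 1)) v)) (m≤n+m _ _)
      where
      kept : ∀ u t i → u ≡ true → u ∧ (t ∨ i) ≡ false → (u ∧ not t) ∧ not i ≡ true
      kept true false false _ _ = refl
      own-term : 1 ≡ δ (ℓ v) (ℓ v) ▸ (Q∖I v ▸ 1)
      own-term rewrite δ-refl (ℓ v) = cong (_▸ 1) (sym (kept (U v) (does (twin? v)) (I v) Uv p))
  -- Each vertex of `Q` outside `I` costs 4 for its lost label and 2 for the larger cosize, and each
  -- vertex of `I` earns 6 from doubled toughness. The net cost 6|Q| - 12|I| is what
  -- `independentSet` bounds.
  arith : ∀ l l′ i s s′ q dq d → 2 * l′ + 3 * i ≤ s′ + 2 → l + i ≤ l′ + q → s′ + i ≡ s + q → 6 * q ≤ 12 * i + dq → dq ≤ d →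
    4 * l ≤ d + 2 * s + 4
  arith l l′ i s s′ q dq d h₁ h₂ h₃ h₄ h₅ =
    lin 0 (+-mono-≤ (scale 2 h₁) (+-mono-≤ (scale 4 h₂) (+-mono-≤ (scale 2 (≤-reflexive h₃)) (+-mono-≤ h₄ h₅))))
      (solve (l ∷ l′ ∷ i ∷ s ∷ s′ ∷ q ∷ dq ∷ d ∷ []))

-- Spanning tight subgraphs

-- With the classes taken to be the maximal tight sets, 4|X| = D m X + 4 for
-- each class X, and all edges of g between classes belong to m.
sparse-bound : ∀ {n} (g : Multi n) → Symm g → Loopless g → Tough g →
  ∀ (m : Multi n) → Sparse m → (∀ x y → m x y ≤ g x y) → ∀ U →
  (∀ u v → U u ≡ true → U v ≡ true → m u v ≡ g u v ⊎ ∃ (TightOn m U u v)) →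
  4 * size U ≤ D m U + 2 * cosize U + 4
sparse-bound {n} g sy ll tg m sp m≤g U dich =
  arith (size U) (D m U) (D (cut m ℓ) U) (D (cut g ℓ) U) (labels U ℓ) (cosize U)
    (classes-bound g sy ll tg ℓ (size U) U ≤-refl) (∑²-mono cut-≤) count
  where
  Zs : ∀ u → ∃ λ Z → U u ≡ true → TightOn m U u u Z × ∀ Y → TightOn m U u u Y → Y ⊆ Z
  Zs u with U u Bool.≟ true
  ... | no ¬p = single u , λ p → ⊥-elim (¬p p)
  ... | yes p with greatestTight sp U u (single u , tight-single m u (n≤0⇒n≡0 (subst (m u u ≤_) (ll u) (m≤g u u))) ,
                     (λ x q → subst (λ w → U w ≡ true) (sym (δ⇒≡ x u q)) p) , δ-refl u , δ-refl u)
  ...   | Z , greatest = Z , λ _ → greatest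
  Z : Fin n → Sub n
  Z u = proj₁ (Zs u)
  Z⊆U : ∀ {u} → U u ≡ true → Z u ⊆ U
  Z⊆U p = proj₁ (proj₂ (proj₁ (proj₂ (Zs _) p)))
  Z-tight : ∀ {u} → U u ≡ true → Tight m (Z u)
  Z-tight p = proj₁ (proj₁ (proj₂ (Zs _) p))
  Z-refl : ∀ {u} → U u ≡ true → Z u u ≡ true
  Z-refl p = proj₁ (proj₂ (proj₂ (proj₁ (proj₂ (Zs _) p))))
  Z-greatest : ∀ {u v} → U u ≡ true → ∀ Y → TightOn m U u v Y → Y ⊆ Z u
  Z-greatest p Y (t , s , q , _) = proj₂ (proj₂ (Zs _) p) Y (t , s , q , q)
  Z-eq : ∀ {u v} → U u ≡ true → Z u v ≡ true → ∀ x → Z u x ≡ Z v x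
  Z-eq {u} {v} p q x = ⇔-bool (u⊆v x) (Z-greatest {v = u} p (Z v) (Z-tight Uv , Z⊆U Uv , u⊆v u (Z-refl p) , u⊆v u (Z-refl p)) x)
    where
    Uv = Z⊆U p v q
    u⊆v : Z u ⊆ Z v
    u⊆v = Z-greatest {v = v} Uv (Z u) (Z-tight p , Z⊆U p , q , q)
  open Classes U Z Z⊆U Z-refl Z-eq renaming (class to ℓ)
  cut-≤ : ∀ x y → (cut g ℓ ↾ U) x y ≤ (cut m ℓ ↾ U) x y
  cut-≤ x y = ▸-monoʳ (U x ∧ U y) λ p → ▸-monoʳ (not (δ (ℓ x) (ℓ y))) λ q →
    g≤m (proj₁ (∧-true p)) (proj₂ (∧-true {U x} p)) (λ e → true≢false (trans (cong (δ (ℓ x)) (sym e)) (δ-refl (ℓ x))) (not-true q))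
    where
    g≤m : U x ≡ true → U y ≡ true → ℓ x ≢ ℓ y → g x y ≤ m x y
    g≤m Ux Uy ne with dich x y Ux Uy
    ... | inj₁ e = ≤-reflexive (sym e)
    ... | inj₂ (Y , on) = ⊥-elim (ne (same-class Ux (Z-greatest {v = y} Ux Y on y (proj₂ (proj₂ (proj₂ on))))))
  X : Fin n → Sub n
  X k x = U x ∧ δ k (ℓ x)
  X-size : ∑ (λ k → size (X k)) ≡ size U
  X-size = trans (∑-swap (λ k x → X k x ▸ 1)) (∑-cong λ x →
    trans (∑-cong (λ k → pt (U x) (δ k (ℓ x)))) (∑-δ (ℓ x) (λ _ → U x ▸ 1)))
    where
    pt : ∀ a b → (a ∧ b) ▸ 1 ≡ b ▸ (a ▸ 1)
    pt true  true  = refl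
    pt true  false = refl
    pt false true  = refl
    pt false false = refl
  X-D : ∑ (λ k → D m (X k)) + D (cut m ℓ) U ≡ D m U
  X-D = begin
    ∑ (λ k → D m (X k)) + D (cut m ℓ) U
      ≡⟨ cong (_+ D (cut m ℓ) U) (trans (∑-swap (λ k x → ∑ (λ y → (m ↾ X k) x y)))
           (∑-cong λ x → trans (∑-swap (λ k y → (m ↾ X k) x y)) (∑-cong λ y →
             trans (∑-cong (λ k → pt (U x) (δ k (ℓ x)) (U y ∧ δ k (ℓ y)) (m x y))) (∑-δ (ℓ x) (λ k → (U x ∧ (U y ∧ δ k (ℓ y))) ▸ m x y))))) ⟩
    ∑² (λ x y → (U x ∧ (U y ∧ δ (ℓ x) (ℓ y))) ▸ m x y) + D (cut m ℓ) U
      ≡⟨ sym (∑²-+ (λ x y → (U x ∧ (U y ∧ δ (ℓ x) (ℓ y))) ▸ m x y) (cut m ℓ ↾ U)) ⟩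
    ∑² (λ x y → (U x ∧ (U y ∧ δ (ℓ x) (ℓ y))) ▸ m x y + (cut m ℓ ↾ U) x y)
      ≡⟨ ∑²-cong (λ x y → recombine (U x) (U y) (δ (ℓ x) (ℓ y)) (m x y)) ⟩
    D m U ∎
    where
    open ≡-Reasoning
    pt : ∀ a b c k → ((a ∧ b) ∧ c) ▸ k ≡ b ▸ ((a ∧ c) ▸ k)
    pt true  true  c k = refl
    pt true  false c k = refl
    pt false true  c k = refl
    pt false false c k = refl
    recombine : ∀ a b c k → (a ∧ (b ∧ c)) ▸ k + (a ∧ b) ▸ (not c ▸ k) ≡ (a ∧ b) ▸ k
    recombine true  true  true  k = +-identityʳ k
    recombine true  true  false k = refl
    recombine true  false c     k = refl
    recombine false b     c     k = refl
  X-tight : ∀ k → 4 * size (X k) ≤ D m (X k) + 4 * (used U ℓ k ▸ 1)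
  X-tight k with used? U ℓ k
  ... | no unused = ≤-trans (≤-reflexive (cong (4 *_) (∑-zero (λ x → cong (_▸ 1) (empty x))))) z≤n
    where
    empty : ∀ x → X k x ≡ false
    empty x with bool (X k x)
    ... | inj₂ p = p
    ... | inj₁ p = ⊥-elim (unused (x , proj₁ (∧-true {U x} p) , sym (δ⇒≡ k (ℓ x) (proj₂ (∧-true {U x} p)))))
  ... | yes (v , Uv , refl) = ≤-reflexive (trans (cong (4 *_) (size-cong X≗Z))
      (trans (sym (Z-tight Uv)) (cong (_+ 4) (D-cong {m = m} (λ _ _ → refl) (λ x → sym (X≗Z x))))))
    where
    X≗Z : ∀ x → X (ℓ v) x ≡ Z v x
    X≗Z x = ⇔-bool
      (λ p → class-same Uv (proj₁ (∧-true {U x} p)) (δ⇒≡ (ℓ v) (ℓ x) (proj₂ (∧-true {U x} p))))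
      (λ p → ∧-intro (Z⊆U Uv x p) (subst (λ w → δ (ℓ v) w ≡ true) (same-class Uv p) (δ-refl (ℓ v))))
  count : 4 * size U + D (cut m ℓ) U ≤ D m U + 4 * labels U ℓ
  count = begin
    4 * size U + D (cut m ℓ) U
      ≡⟨ cong (_+ D (cut m ℓ) U) (trans (cong (4 *_) (sym X-size)) (sym (∑-* 4 (λ k → size (X k))))) ⟩
    ∑ (λ k → 4 * size (X k)) + D (cut m ℓ) U
      ≤⟨ +-monoˡ-≤ (D (cut m ℓ) U) (∑-mono X-tight) ⟩
    ∑ (λ k → D m (X k) + 4 * (used U ℓ k ▸ 1)) + D (cut m ℓ) U
      ≡⟨ cong (_+ D (cut m ℓ) U) (trans (∑-+ (λ k → D m (X k)) (λ k → 4 * (used U ℓ k ▸ 1))) (cong (∑ (λ k → D m (X k)) +_) (∑-* 4 (λ k → used U ℓ k ▸ 1)))) ⟩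
    ∑ (λ k → D m (X k)) + 4 * labels U ℓ + D (cut m ℓ) U
      ≡⟨ rearrange (∑ (λ k → D m (X k))) (4 * labels U ℓ) (D (cut m ℓ) U) ⟩
    ∑ (λ k → D m (X k)) + D (cut m ℓ) U + 4 * labels U ℓ
      ≡⟨ cong (_+ 4 * labels U ℓ) X-D ⟩
    D m U + 4 * labels U ℓ ∎
    where
    open ≤-Reasoning
    rearrange : ∀ a b c → a + b + c ≡ a + c + b
    rearrange = solve-∀
  arith : ∀ s d c c′ l co → 4 * l ≤ c′ + 2 * co + 4 → c′ ≤ c → 4 * s + c ≤ d + 4 * l → 4 * s ≤ d + 2 * co + 4
  arith s d c c′ l co h₁ h₂ h₃ = lin 0 (+-mono-≤ h₁ (+-mono-≤ h₂ h₃)) (solve (s ∷ d ∷ c ∷ c′ ∷ l ∷ co ∷ []))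

record SpanningTight {n : ℕ} (g : Multi n) : Set where
  field
    graph  : Multi n
    sy     : Symm graph
    sparse : Sparse graph
    ≤g     : ∀ x y → graph x y ≤ g x y
    tight  : Tight graph full

add-≤ : ∀ {n} {m g : Multi n} → Symm m → Symm g → (∀ x y → m x y ≤ g x y) → ∀ {u v} → u ≢ v → m u v < g u v →
  ∀ x y → m x y + Ed u v x y ≤ g x y
add-≤ {m = m} {g} sm sg m≤g ne lt x y = ≤-trans
  (+-monoʳ-≤ (m x y) (Ed-≤ (λ x y → g x y ∸ m x y) (λ x y → cong₂ _∸_ (sg x y) (sm x y)) ne (m<n⇒0<n∸m lt) x y))
  (≤-reflexive (m+[n∸m]≡n (m≤g x y)))

add-sym : ∀ {n} {m : Multi n} → Symm m → ∀ u v → Symm (λ x y → m x y + Ed u v x y)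
add-sym s u v x y = cong₂ _+_ (s x y) (Ed-sym u v x y)

-- A maximal sparse subgraph of g.
spanningTight : ∀ {n} → 1 ≤ n → (g : Multi n) → Symm g → Loopless g → Tough g → SpanningTight g
spanningTight {suc n′} _ g sg lg tg = grow (∑² g) (λ _ _ → 0) (m≤m+n _ _) (λ _ _ → refl) sparse-zero (λ _ _ → z≤n)
  where
  n = suc n′
  sparse-zero : Sparse {n} (λ _ _ → 0)
  sparse-zero X u p = ≤-trans (≤-reflexive (cong (_+ 4) (∑²-zero {n} (λ x y → ▸-zero (X x ∧ X y))))) (scale 4 (size-pos X u p))
  grow : ∀ k m → ∑² g ≤ k + ∑² m → Symm m → Sparse m → (∀ x y → m x y ≤ g x y) → SpanningTight g
  grow k m le sm sp m≤g with any? (λ u → any? (λ v → (m u v <? g u v) ×-dec ¬? (anyTight? m full u v)))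
  ... | no none = record { graph = m ; sy = sm ; sparse = sp ; ≤g = m≤g ; tight = full-tight }
    where
    dich : ∀ u v → full {n} u ≡ true → full {n} v ≡ true → m u v ≡ g u v ⊎ ∃ (TightOn m full u v)
    dich u v _ _ with anyTight? m full u v
    ... | yes t = inj₂ t
    ... | no ¬t = inj₁ (≤-antisym (m≤g u v) (≮⇒≥ λ lt → none (u , v , lt , ¬t)))
    -- With nothing outside `U`, `sparse-bound` is exactly the reverse of sparsity.
    full-tight : Tight m full
    full-tight = ≤-antisym (sp full Fin.zero refl)
      (≤-trans (sparse-bound g sg lg tg m sp m≤g full dich) (≤-reflexive (cong (_+ 4) (trans (cong (λ c → D m full + 2 * c) (∑-zero {n} (λ _ → refl))) (+-identityʳ _)))))
  ... | yes (u , v , lt , ¬t) = next k le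
    where
    u≢v : u ≢ v
    u≢v refl = n≮0 (subst (m u u <_) (lg u) lt)
    m′ : Multi n
    m′ x y = m x y + Ed u v x y
    m′≤g : ∀ x y → m′ x y ≤ g x y
    m′≤g = add-≤ sm sg m≤g u≢v lt
    lm : Loopless m
    lm x = n≤0⇒n≡0 (subst (m x x ≤_) (lg x) (m≤g x x))
    ∑²-m′ : ∑² m′ ≡ ∑² m + 2
    ∑²-m′ = trans (∑²-+ m (Ed u v)) (cong (∑² m +_) (D-Ed u v full))
    next : ∀ k → ∑² g ≤ k + ∑² m → SpanningTight g
    next zero    le = ⊥-elim (<⇒≱ (subst (∑² m <_) (sym ∑²-m′) (m<m+n (∑² m) (s≤s z≤n))) (≤-trans (∑²-mono m′≤g) le))
    next (suc k) le = grow k m′ (≤-trans le (≤-trans (≤-reflexive (sym (+-suc k (∑² m)))) (+-monoʳ-≤ k (subst (∑² m <_) (sym ∑²-m′) (m<m+n (∑² m) (s≤s z≤n))))))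
      (add-sym sm u v) (sparse-add sm lm sp (λ Y Yu Yv tY → ¬t (Y , tY , (λ _ _ → refl) , Yu , Yv))) m′≤g

-- Replacing a tight part

▸-cong : ∀ b {k l} → (b ≡ true → k ≡ l) → b ▸ k ≡ b ▸ l
▸-cong true  f = f refl
▸-cong false f = refl

D-remove : ∀ {n} (m : Multi n) → Symm m → Loopless m → ∀ X w → X w ≡ true →
  D m X ≡ D m (X - w) + 2 * ∑ (λ y → X y ▸ m w y)
D-remove {n} m sy ll X w Xw = begin
  D m X
    ≡⟨ ∑²-cong (λ x y → pt x y (x ≟ w) (y ≟ w)) ⟩
  ∑² (λ x y → (m ↾ (X - w)) x y + (row x y + row y x))
    ≡⟨ trans (∑²-+ (m ↾ (X - w)) (λ x y → row x y + row y x)) (cong (D m (X - w) +_) (∑²-+ row (λ x y → row y x))) ⟩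
  D m (X - w) + (∑² row + ∑² (λ x y → row y x))
    ≡⟨ cong (D m (X - w) +_) (cong₂ _+_ rows (trans (∑-swap (λ x y → row y x)) rows)) ⟩
  D m (X - w) + (∑ (λ y → X y ▸ m w y) + ∑ (λ y → X y ▸ m w y))
    ≡⟨ cong (λ k → D m (X - w) + (∑ (λ y → X y ▸ m w y) + k)) (sym (+-identityʳ _)) ⟩
  D m (X - w) + 2 * ∑ (λ y → X y ▸ m w y) ∎
  where
  open ≡-Reasoning
  row : Multi n
  row x y = δ x w ▸ (X y ▸ m w y)
  rows : ∑² row ≡ ∑ (λ y → X y ▸ m w y)
  rows = trans (∑-cong (λ x → ∑-▸ (δ x w) (λ y → X y ▸ m w y))) (∑-δ w (λ _ → ∑ (λ y → X y ▸ m w y)))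
  pt : ∀ x y → Dec (x ≡ w) → Dec (y ≡ w) → (m ↾ X) x y ≡ (m ↾ (X - w)) x y + (row x y + row y x)
  pt x y (yes refl) (yes refl) rewrite ll x = trans (▸-zero (X x ∧ X x)) (sym (cong₂ _+_ (▸-zero ((X - x) x ∧ (X - x) x)) (cong₂ _+_ dd dd)))
    where
    dd : δ x x ▸ (X x ▸ 0) ≡ 0
    dd = trans (cong (δ x x ▸_) (▸-zero (X x))) (▸-zero (δ x x))
  pt x y (yes refl) (no q) rewrite δ-refl x | δ-≢ q | Xw = sym (+-identityʳ _)
  pt x y (no p) (yes refl) rewrite δ-refl y | δ-≢ p | Xw | Bool.∧-zeroʳ (X x ∧ true) | Bool.∧-identityʳ (X x) = cong (X x ▸_) (sy x y)
  pt x y (no p) (no q) rewrite δ-≢ p | δ-≢ q | Bool.∧-identityʳ (X x) | Bool.∧-identityʳ (X y) = sym (+-identityʳ _)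

-- Deleting `w` lowers `D` by twice the degree of `w` in `X`. What remains is nonempty, thanks to
-- `u`, hence sparse, so the fall is at least 4.
tight-degree : ∀ {n} {m : Multi n} → Symm m → Loopless m → Sparse m → ∀ {X} w u → Tight m X →
  X w ≡ true → X u ≡ true → u ≢ w → 2 ≤ ∑ (λ y → X y ▸ m w y)
tight-degree {m = m} sy ll sp {X} w u t Xw Xu u≢w = arith (D m X) (D m (X - w)) (size X) (size (X - w)) (∑ (λ y → X y ▸ m w y))
  t (D-remove m sy ll X w Xw) (sp (X - w) u (-intro {X = X} Xu u≢w)) (size-remove X w Xw)
  where
  arith : ∀ d d′ s s′ k → d + 4 ≡ 4 * s → d ≡ d′ + 2 * k → d′ + 4 ≤ 4 * s′ → s ≡ s′ + 1 → 2 ≤ k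
  arith d d′ s s′ k h₁ h₂ h₃ h₄ = *-cancelˡ-≤ 2 (lin 0
    (+-mono-≤ (≤-reflexive (sym h₁)) (+-mono-≤ (≤-reflexive h₂) (+-mono-≤ h₃ (scale 4 (≤-reflexive (sym h₄))))))
    (solve (d ∷ d′ ∷ s ∷ s′ ∷ k ∷ [])))

Agree : ∀ {n} → Multi n → Multi n → Sub n → Set
Agree A B K = ∀ x y → K x ∧ K y ≡ false → A x y ≡ B x y

-- A change confined to `K` that keeps the number of edges in `K` is invisible to larger sets, so
-- their tightness carries over.
agree-D : ∀ {n} {A B : Multi n} K → Agree A B K → D A K ≡ D B K → ∀ {Z} → K ⊆ Z → D A Z ≡ D B Z
agree-D {n} {A} {B} K agree same {Z} K⊆Z = trans (split A) (trans (cong₂ _+_ same (∑²-cong outer)) (sym (split B)))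
  where
  rest : Multi n → Multi n
  rest m x y = not (K x ∧ K y) ▸ (m ↾ Z) x y
  split : ∀ m → D m Z ≡ D m K + ∑² (rest m)
  split m = trans (∑²-cong (λ x y → pt (K x ∧ K y) (Z x ∧ Z y) (m x y)
    (λ p → ∧-intro (K⊆Z x (proj₁ (∧-true p))) (K⊆Z y (proj₂ (∧-true {K x} p)))))) (∑²-+ (m ↾ K) (rest m))
    where
    pt : ∀ a b k → (a ≡ true → b ≡ true) → b ▸ k ≡ a ▸ k + not a ▸ (b ▸ k)
    pt true  b k f rewrite f refl = sym (+-identityʳ k)
    pt false b k f = refl
  outer : ∀ x y → rest A x y ≡ rest B x y
  outer x y = ▸-cong (not (K x ∧ K y)) (λ p → cong ((Z x ∧ Z y) ▸_) (agree x y (not-true p)))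

agree-row : ∀ {n} {A B : Multi n} K → Agree A B K → ∀ {x} → K x ≡ false → deg A x ≡ deg B x
agree-row K agree {x} p = ∑-cong λ y → agree x y (cong (_∧ K y) p)

-- A set meeting `K` is uncrossed with `K`: the union counts as in `A`, the intersection falls under
-- the last hypothesis, and `K` itself has equality. A set missing `K` sees no change.
replace-sparse : ∀ {n} {A C : Multi n} {K} u → Sparse A → Tight A K → K u ≡ true → Agree C A K → D C K ≡ D A K →
  (∀ Y y → Y y ≡ true → Y ⊆ K → D C Y + 4 ≤ 4 * size Y) → Sparse C
replace-sparse {A = A} {C} {K} u sp t Ku agree same inner Y y Yy with any? (λ x → (Y x ∧ K x) Bool.≟ true)
... | yes (x , p) = arith (D C Y) (D C K) (D C (Y ∪ K)) (D C (Y ∩ K)) (size (Y ∪ K)) (size (Y ∩ K)) (size Y) (size K)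
  (D-submodular C Y K)
  (subst (λ d → d + 4 ≤ 4 * size (Y ∪ K)) (sym (agree-D K agree same {Y ∪ K} (λ z q → ∨-introʳ {Y z} q))) (sp (Y ∪ K) y (∨-introˡ Yy)))
  (inner (Y ∩ K) x p (λ z q → proj₂ (∧-true {Y z} q)))
  (size-∪∩ Y K) (trans (cong (_+ 4) same) t)
  where
  arith : ∀ a b c d p q r s → a + b ≤ c + d → c + 4 ≤ 4 * p → d + 4 ≤ 4 * q → p + q ≡ r + s → b + 4 ≡ 4 * s → a + 4 ≤ 4 * r
  arith a b c d p q r s h₁ h₂ h₃ h₄ h₅ = lin 0 (+-mono-≤ h₁ (+-mono-≤ h₂ (+-mono-≤ h₃ (+-mono-≤ (scale 4 (≤-reflexive h₄)) (≤-reflexive (sym h₅))))))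
    (solve (a ∷ b ∷ c ∷ d ∷ p ∷ q ∷ r ∷ s ∷ []))
... | no disjoint = subst (λ d → d + 4 ≤ 4 * size Y) (∑²-cong (λ a b → ▸-cong (Y a ∧ Y b) (λ p → sym (agree a b (cong (_∧ K b) (K-out a (proj₁ (∧-true p)))))))) (sp Y y Yy)
  where
  K-out : ∀ a → Y a ≡ true → K a ≡ false
  K-out a Ya with bool (K a)
  ... | inj₁ p = ⊥-elim (disjoint (a , ∧-intro Ya p))
  ... | inj₂ p = p

-- `agree` and `same` keep the number of edges on every set containing `K`, in particular on the
-- whole vertex set; so rerouting a spanning tight graph gives a spanning tight graph.
record Reroute {n : ℕ} (g H : Multi n) (K : Sub n) : Set where
  field
    graph  : Multi n
    sy     : Symm graph
    sparse : Sparse graph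
    ≤g     : ∀ x y → graph x y ≤ g x y
    agree  : Agree graph H K
    same   : D graph K ≡ D H K

∉-false : ∀ {n} {X : Sub n} {x} → ¬ X x ≡ true → X x ≡ false
∉-false {X = X} {x} p with bool (X x)
... | inj₁ q = ⊥-elim (p q)
... | inj₂ q = q

-- The first rerouting does not touch the edges inside `K₂`, so `K₂` is still tight and its inside
-- can be replaced next. Degrees are inherited separately on `K₁`, on `K₂` and elsewhere.
module Merge {n} {g H : Multi n} {K₁ K₂ : Sub n} (R₁ : Reroute g H K₁) (R₂ : Reroute g H K₂)
  (disjoint : ∀ x → K₁ x ≡ true → K₂ x ≡ true → ⊥) (tight₂ : Tight H K₂) (v : Fin n) (K₂v : K₂ v ≡ true) where

  private
    module R₁ = Reroute R₁
    module R₂ = Reroute R₂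

  C : Multi n
  C x y = if K₂ x ∧ K₂ y then R₂.graph x y else R₁.graph x y

  C-in : ∀ x y → K₂ x ∧ K₂ y ≡ true → C x y ≡ R₂.graph x y
  C-in x y p rewrite p = refl

  C-out : Agree C R₁.graph K₂
  C-out x y p rewrite p = refl

  K₁-out : ∀ {x} → K₂ x ≡ true → K₁ x ≡ false
  K₁-out {x} p = ∉-false {X = K₁} (λ q → disjoint x q p)

  K₂-out : ∀ {x} → K₁ x ≡ true → K₂ x ≡ false
  K₂-out {x} p = ∉-false {X = K₂} (disjoint x p)

  D-K₂ : D C K₂ ≡ D R₁.graph K₂
  D-K₂ = trans (∑²-cong (λ x y → ▸-cong (K₂ x ∧ K₂ y) (C-in x y))) (trans R₂.same
    (∑²-cong (λ x y → ▸-cong (K₂ x ∧ K₂ y) (λ p → sym (R₁.agree x y (cong (_∧ K₁ y) (K₁-out (proj₁ (∧-true p)))))))))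

  D-K₂-H : D R₁.graph K₂ ≡ D H K₂
  D-K₂-H = trans (sym D-K₂) (trans (∑²-cong (λ x y → ▸-cong (K₂ x ∧ K₂ y) (C-in x y))) R₂.same)

  merged : Reroute g H (K₁ ∪ K₂)
  merged = record
    { graph  = C
    ; sy     = λ x y → cong₂ (λ b (p : ℕ × ℕ) → if b then proj₁ p else proj₂ p) (Bool.∧-comm (K₂ x) (K₂ y)) (cong₂ _,_ (R₂.sy x y) (R₁.sy x y))
    ; sparse = replace-sparse v R₁.sparse (trans (cong (_+ 4) D-K₂-H) tight₂) K₂v C-out D-K₂
        (λ Y y Yy Y⊆K → subst (λ d → d + 4 ≤ 4 * size Y)
          (∑²-cong (λ a b → ▸-cong (Y a ∧ Y b) (λ p → sym (C-in a b (∧-intro (Y⊆K a (proj₁ (∧-true p))) (Y⊆K b (proj₂ (∧-true {Y a} p)))))))) (R₂.sparse Y y Yy))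
    ; ≤g     = ≤g
    ; agree  = agree
    ; same   = trans (agree-D K₂ C-out D-K₂ {K₁ ∪ K₂} (λ x p → ∨-introʳ {K₁ x} p)) (agree-D K₁ R₁.agree R₁.same {K₁ ∪ K₂} (λ x p → ∨-introˡ {K₁ x} p))
    }
    where
    ≤g : ∀ x y → C x y ≤ g x y
    ≤g x y with K₂ x ∧ K₂ y
    ... | true  = R₂.≤g x y
    ... | false = R₁.≤g x y
    agree : Agree C H (K₁ ∪ K₂)
    agree x y p = trans (C-out x y (weaken (K₁ x) (K₁ y) p)) (R₁.agree x y (weaken′ (K₁ x) (K₁ y) p))
      where
      weaken : ∀ a b {c d} → (a ∨ c) ∧ (b ∨ d) ≡ false → c ∧ d ≡ false
      weaken a     b     {false}         _ = refl
      weaken a     b     {true}  {false} _ = refl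
      weaken true  true  {true}  {true}  ()
      weaken true  false {true}  {true}  ()
      weaken false true  {true}  {true}  ()
      weaken false false {true}  {true}  ()
      weaken′ : ∀ a b {c d} → (a ∨ c) ∧ (b ∨ d) ≡ false → a ∧ b ≡ false
      weaken′ true  true  ()
      weaken′ true  false _ = refl
      weaken′ false b     _ = refl

  deg-K₁ : ∀ {x} → K₁ x ≡ true → deg C x ≡ deg R₁.graph x
  deg-K₁ p = agree-row K₂ C-out (K₂-out p)

  deg-K₂ : ∀ {x} → K₂ x ≡ true → deg C x ≡ deg R₂.graph x
  deg-K₂ {x} p = ∑-cong row
    where
    row : ∀ y → C x y ≡ R₂.graph x y
    row y with bool (K₂ y)
    ... | inj₁ q = C-in x y (∧-intro p q)
    ... | inj₂ q = trans (C-out x y K₂y) (trans (R₁.agree x y (cong (_∧ K₁ y) (K₁-out p))) (sym (R₂.agree x y K₂y)))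
      where
      K₂y : K₂ x ∧ K₂ y ≡ false
      K₂y = trans (cong (K₂ x ∧_) q) (Bool.∧-zeroʳ (K₂ x))

  deg-out : ∀ {x} → K₁ x ≡ false → K₂ x ≡ false → deg C x ≡ deg H x
  deg-out p q = trans (agree-row K₂ C-out q) (agree-row K₁ R₁.agree p)

-- Lowering the degrees to five

-- The witness that `u`, even at degree 5, can make room for one more edge: the rearrangement stays
-- inside a tight subset of `U` and pushes no vertex of it above 5.
record Flexible {n : ℕ} (g H : Multi n) (U : Sub n) (u : Fin n) : Set where
  field
    K       : Sub n
    K⊆U     : K ⊆ U
    K∋      : K u ≡ true
    tight   : Tight H K
    reroute : Reroute g H K
    low     : deg (Reroute.graph reroute) u ≤ 4
    bound   : ∀ x → K x ≡ true → deg (Reroute.graph reroute) x ≤ 5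

-- The outcome of one exchange at `w`, used in two ways: if `w` has degree at least 6, the exchange
-- is carried out and is progress; if `w` has degree 5, it is kept as the witness that `w` is
-- flexible.
record Relief {n : ℕ} (g H : Multi n) (Z : Sub n) (w : Fin n) : Set where
  field
    reroute : Reroute g H Z
    bound   : ∀ x → deg (Reroute.graph reroute) x ≤ 5 ⊎ deg (Reroute.graph reroute) x ≤ deg H x
    drop    : deg (Reroute.graph reroute) w < deg H w

-- The edge uv is exchanged for an edge at w of the fundamental circuit of uv,
-- which lives on the least tight set containing u and v.
augment : ∀ {n} {g : Multi n} → Symm g → Loopless g → (T : SpanningTight g) → let H = SpanningTight.graph T in
  ∀ U u v → U u ≡ true → U v ≡ true → Flexible g H U u → Flexible g H U v → H u v < g u v → ¬ ∃ (TightOn H U u v) →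
  ∃ λ Z → Tight H Z × Z u ≡ true × Z v ≡ true × (∀ w → Z w ≡ true → U w ≡ false → Relief g H Z w)
augment {n} {g} sg lg T U u v Uu Uv Fu Fv lt ¬tight =
  Z , Z-tight-H , ∨-introʳ {D₀ u} (∨-introˡ {Fu.K u} Fu.K∋) , ∨-introʳ {D₀ v} (∨-introʳ {Fu.K v} Fv.K∋) , relief
  where
  open SpanningTight T renaming (graph to H; sy to sH; sparse to spH; ≤g to H≤g; tight to tH)
  module Fu = Flexible Fu
  module Fv = Flexible Fv
  -- Otherwise the union of the two sets would be a tight subset of `U` containing `u` and `v`.
  disjoint : ∀ x → Fu.K x ≡ true → Fv.K x ≡ true → ⊥
  disjoint x p q = ¬tight (Fu.K ∪ Fv.K , proj₁ (tight-∪∩ spH x p q Fu.tight Fv.tight) , into , ∨-introˡ Fu.K∋ , ∨-introʳ {Fu.K v} Fv.K∋)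
    where
    into : (Fu.K ∪ Fv.K) ⊆ U
    into y r with ∨-true {Fu.K y} r
    ... | inj₁ a = Fu.K⊆U y a
    ... | inj₂ a = Fv.K⊆U y a
  open Merge Fu.reroute Fv.reroute disjoint Fv.tight v Fv.K∋
  open Reroute merged renaming (sy to sC; sparse to spC; ≤g to C≤g; agree to C-agree; same to C-same) using ()
  u≢v : u ≢ v
  u≢v refl = n≮0 (subst (H u u <_) (lg u) lt)
  lC : Loopless C
  lC x = n≤0⇒n≡0 (subst (C x x ≤_) (lg x) (C≤g x x))
  K : Sub n
  K = Fu.K ∪ Fv.K
  D-above : ∀ Y → K ⊆ Y → D C Y ≡ D H Y
  D-above Y K⊆Y = agree-D K C-agree C-same {Y} K⊆Y
  abstract
    least : ∃ λ Z → TightOn C full u v Z × ∀ Y → Y u ≡ true → Y v ≡ true → Tight C Y → Z ⊆ Y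
    least = leastTight spC u v (full , trans (cong (_+ 4) (D-above full (λ _ _ → refl))) tH , (λ _ _ → refl) , refl , refl)
  D₀ : Sub n
  D₀ = proj₁ least
  D₀-tight : Tight C D₀
  D₀-tight = proj₁ (proj₁ (proj₂ least))
  D₀u : D₀ u ≡ true
  D₀u = proj₁ (proj₂ (proj₂ (proj₁ (proj₂ least))))
  D₀v : D₀ v ≡ true
  D₀v = proj₂ (proj₂ (proj₂ (proj₁ (proj₂ least))))
  D₀-least : ∀ Y → Y u ≡ true → Y v ≡ true → Tight C Y → D₀ ⊆ Y
  D₀-least = proj₂ (proj₂ least)
  -- The exchanged graph differs from `H` on the least tight set and on both rerouted sets. The
  -- union is tight since the former meets the latter in `u` and in `v`.
  Z : Sub n
  Z = D₀ ∪ K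
  Ku-tight : Tight C Fu.K
  Ku-tight = trans (cong (_+ 4) (trans (∑²-cong (λ x y → ▸-cong (Fu.K x ∧ Fu.K y) (λ p → C-out x y (cong (_∧ Fv.K y) (K₂-out (proj₁ (∧-true p)))))))
    (Reroute.same Fu.reroute))) Fu.tight
  Kv-tight : Tight C Fv.K
  Kv-tight = trans (cong (_+ 4) (trans D-K₂ D-K₂-H)) Fv.tight
  Z-tight : Tight C Z
  Z-tight = trans (cong (_+ 4) (D-cong {m = C} (λ _ _ → refl) assoc)) (trans Z′-tight (cong (4 *_) (size-cong (λ x → sym (assoc x)))))
    where
    assoc : ∀ x → Z x ≡ ((D₀ ∪ Fu.K) ∪ Fv.K) x
    assoc x = sym (Bool.∨-assoc (D₀ x) (Fu.K x) (Fv.K x))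
    Z′-tight : Tight C ((D₀ ∪ Fu.K) ∪ Fv.K)
    Z′-tight = proj₁ (tight-∪∩ spC v (∨-introˡ {D₀ v} D₀v) Fv.K∋ (proj₁ (tight-∪∩ spC u D₀u Fu.K∋ D₀-tight Ku-tight)) Kv-tight)
  Z-tight-H : Tight H Z
  Z-tight-H = trans (cong (_+ 4) (sym (D-above Z (λ x → ∨-introʳ {D₀ x})))) Z-tight
  -- Neither rerouting touches an edge between the two disjoint sets, so a copy of uv is still
  -- available.
  Cuv : C u v ≡ H u v
  Cuv = trans (C-out u v (cong (_∧ Fv.K v) (K₂-out Fu.K∋)))
    (Reroute.agree Fu.reroute u v (trans (cong (Fu.K u ∧_) (K₁-out Fv.K∋)) (Bool.∧-zeroʳ (Fu.K u))))
  relief : ∀ w → Z w ≡ true → U w ≡ false → Relief g H Z w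
  relief w Zw ¬Uw = exchange (∑-pos (λ y → D₀ y ▸ C w y) (≤-trans (s≤s z≤n)
      (tight-degree sC lC spC {D₀} w u D₀-tight D₀w D₀u (λ e → outside-U Uu (sym e)))))
    where
    outside-U : ∀ {x} → U x ≡ true → w ≢ x
    outside-U p refl = true≢false p ¬Uw
    -- Both rerouted sets lie inside `U`, and `w` does not.
    D₀w : D₀ w ≡ true
    D₀w with ∨-true {D₀ w} Zw
    ... | inj₁ p = p
    ... | inj₂ p with ∨-true {Fu.K w} p
    ...   | inj₁ q = ⊥-elim (outside-U (Fu.K⊆U w q) refl)
    ...   | inj₂ q = ⊥-elim (outside-U (Fv.K⊆U w q) refl)
    exchange : (∃ λ z → 0 < D₀ z ▸ C w z) → Relief g H Z w
    exchange (z , pos) = record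
      { reroute = record
        { graph = E ; sy = add-sym sR u v ; sparse = sparse-add sR lR spR rigid
        ; ≤g = add-≤ sR sg (λ x y → ≤-trans (R≤C x y) (C≤g x y)) u≢v (≤-<-trans (≤-trans (R≤C u v) (≤-reflexive Cuv)) lt)
        ; agree = agree-E
        ; same = trans (+-cancelʳ-≡ 2 (D E Z) (D C Z) D-E) (D-above Z (λ x → ∨-introʳ {D₀ x})) }
      ; bound = bound
      ; drop = drop }
      where
      D₀z : D₀ z ≡ true
      D₀z with D₀ z
      ... | true  = refl
      ... | false = ⊥-elim (n≮0 pos)
      Cwz : 0 < C w z
      Cwz = ≤-trans pos (▸-≤ (D₀ z) (C w z))
      w≢z : w ≢ z
      w≢z refl = n≮0 (subst (0 <_) (lC w) Cwz)
      -- The exchange removes the edge wz, which lies inside the least tight set, and adds uv.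
      R E : Multi n
      R x y = C x y ∸ Ed w z x y
      E x y = R x y + Ed u v x y
      R+ : ∀ x y → R x y + Ed w z x y ≡ C x y
      R+ x y = m∸n+n≡m (Ed-≤ C sC w≢z Cwz x y)
      R≤C : ∀ x y → R x y ≤ C x y
      R≤C x y = m∸n≤m (C x y) (Ed w z x y)
      sR : Symm R
      sR x y = cong₂ _∸_ (sC x y) (Ed-sym w z x y)
      lR : Loopless R
      lR x = n≤0⇒n≡0 (subst (R x x ≤_) (lC x) (R≤C x x))
      spR : Sparse R
      spR = sparse-mono R≤C spC
      D-R : ∀ Y → D R Y + 2 * ((Y w ∧ Y z) ▸ 1) ≡ D C Y
      D-R Y = trans (cong (D R Y +_) (sym (D-Ed w z Y))) (trans (sym (D-+ R (Ed w z) Y)) (D-cong {X = Y} R+ (λ _ → refl)))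
      -- A set through `u` and `v` that is tight without wz is also tight in `C`, hence contains
      -- `D₀` and with it the edge wz, whose removal should have cost it 2.
      rigid : ∀ Y → Y u ≡ true → Y v ≡ true → ¬ Tight R Y
      rigid Y Yu Yv t = contra (D R Y) (D C Y) (size Y) t tC (trans (cong (λ b → D R Y + 2 * (b ▸ 1)) (sym (∧-intro (Y⊇ w D₀w) (Y⊇ z D₀z)))) (D-R Y))
        where
        tC : Tight C Y
        tC = tight-mono R≤C spC {Y} u Yu t
        Y⊇ : D₀ ⊆ Y
        Y⊇ = D₀-least Y Yu Yv tC
        contra : ∀ a b s → a + 4 ≡ 4 * s → b + 4 ≡ 4 * s → a + 2 ≡ b → ⊥
        contra a b s p q r = m≢1+n+m a (trans (+-cancelʳ-≡ 4 a b (trans p (sym q))) (trans (sym r) (+-comm a 2)))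
      D-E : D E Z + 2 ≡ D C Z + 2
      D-E = begin
        D E Z + 2                                ≡⟨ cong (_+ 2) (trans (D-+ R (Ed u v) Z) (cong (D R Z +_) (D-Ed u v Z))) ⟩
        D R Z + 2 * ((Z u ∧ Z v) ▸ 1) + 2        ≡⟨ cong (λ b → D R Z + 2 * (b ▸ 1) + 2) (∧-intro (∨-introˡ {D₀ u} D₀u) (∨-introˡ {D₀ v} D₀v)) ⟩
        D R Z + 2 + 2                            ≡⟨ cong (λ b → D R Z + 2 * (b ▸ 1) + 2) (sym (∧-intro Zw (∨-introˡ {D₀ z} D₀z))) ⟩
        D R Z + 2 * ((Z w ∧ Z z) ▸ 1) + 2        ≡⟨ cong (_+ 2) (D-R Z) ⟩
        D C Z + 2                                ∎
        where open ≡-Reasoning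
      agree-E : Agree E H Z
      agree-E x y p = trans (cong₂ _+_ (trans (cong (C x y ∸_) (Ed-off (inside Zw Zz) (inside Zz Zw))) (C-agree x y K-out)) (Ed-off (inside Zu Zv) (inside Zv Zu))) (+-identityʳ (H x y))
        where
        Zu = ∨-introˡ {D₀ u} {K u} D₀u
        Zv = ∨-introˡ {D₀ v} {K v} D₀v
        Zz = ∨-introˡ {D₀ z} {K z} D₀z
        inside : ∀ {a b} → Z a ≡ true → Z b ≡ true → ¬ (x ≡ a × y ≡ b)
        inside Za Zb (refl , refl) = true≢false (∧-intro Za Zb) p
        K-out : K x ∧ K y ≡ false
        K-out = ∉-false {X = λ y → K x ∧ K y} (λ q → true≢false (∧-intro (∨-introʳ {D₀ x} (proj₁ (∧-true q))) (∨-introʳ {D₀ y} (proj₂ (∧-true {K x} q)))) p)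
      deg-E : ∀ x → deg E x + (δ x w ▸ 1 + δ x z ▸ 1) ≡ deg C x + (δ x u ▸ 1 + δ x v ▸ 1)
      deg-E x = begin
        deg E x + (δ x w ▸ 1 + δ x z ▸ 1)  ≡⟨ cong₂ _+_ (∑-+ (R x) (Ed u v x)) (sym (deg-Ed w z x)) ⟩
        deg R x + deg (Ed u v) x + deg (Ed w z) x  ≡⟨ swap (deg R x) (deg (Ed u v) x) (deg (Ed w z) x) ⟩
        deg R x + deg (Ed w z) x + deg (Ed u v) x  ≡⟨ cong₂ _+_ (trans (sym (∑-+ (R x) (Ed w z x))) (∑-cong (R+ x))) (deg-Ed u v x) ⟩
        deg C x + (δ x u ▸ 1 + δ x v ▸ 1)  ∎
        where
        open ≡-Reasoning
        swap : ∀ a b c → a + b + c ≡ a + c + b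
        swap = solve-∀
      deg-E≤ : ∀ x {k} → δ x u ▸ 1 + δ x v ▸ 1 ≡ k → deg E x ≤ deg C x + k
      deg-E≤ x refl = ≤-trans (m≤m+n _ _) (≤-reflexive (deg-E x))
      -- The reroutings left `u` and `v` at degree at most 4, so they end at 5 at most. No other
      -- vertex gains in the exchange itself, so it keeps the cap of its rerouted set or its degree
      -- in `H`.
      bound : ∀ x → deg E x ≤ 5 ⊎ deg E x ≤ deg H x
      bound x = at (x ≟ u) (x ≟ v)
        where
        other : deg E x ≤ deg C x → Fu.K x ≡ true ⊎ Fu.K x ≡ false → Fv.K x ≡ true ⊎ Fv.K x ≡ false → deg E x ≤ 5 ⊎ deg E x ≤ deg H x
        other E≤C (inj₁ a) _        = inj₁ (≤-trans E≤C (≤-trans (≤-reflexive (deg-K₁ a)) (Fu.bound x a)))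
        other E≤C (inj₂ _) (inj₁ b) = inj₁ (≤-trans E≤C (≤-trans (≤-reflexive (deg-K₂ b)) (Fv.bound x b)))
        other E≤C (inj₂ a) (inj₂ b) = inj₂ (≤-trans E≤C (≤-reflexive (deg-out a b)))
        at : Dec (x ≡ u) → Dec (x ≡ v) → deg E x ≤ 5 ⊎ deg E x ≤ deg H x
        at (yes refl) _ = inj₁ (≤-trans (deg-E≤ x (cong₂ (λ a b → a ▸ 1 + b ▸ 1) (δ-refl x) (δ-≢ u≢v)))
          (+-monoˡ-≤ 1 (≤-trans (≤-reflexive (deg-K₁ Fu.K∋)) Fu.low)))
        at (no p) (yes refl) = inj₁ (≤-trans (deg-E≤ x (cong₂ (λ a b → a ▸ 1 + b ▸ 1) (δ-≢ p) (δ-refl x)))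
          (+-monoˡ-≤ 1 (≤-trans (≤-reflexive (deg-K₂ Fv.K∋)) Fv.low)))
        at (no p) (no q) = other (≤-trans (deg-E≤ x (cong₂ (λ a b → a ▸ 1 + b ▸ 1) (δ-≢ p) (δ-≢ q))) (≤-reflexive (+-identityʳ _)))
          (bool (Fu.K x)) (bool (Fv.K x))
      drop : deg E w < deg H w
      drop = begin
        suc (deg E w)                        ≡⟨ +-comm 1 (deg E w) ⟩
        deg E w + 1                          ≤⟨ +-monoʳ-≤ (deg E w) (≤-trans (≤-reflexive (cong (_▸ 1) (sym (δ-refl w)))) (m≤m+n _ _)) ⟩
        deg E w + (δ w w ▸ 1 + δ w z ▸ 1)    ≡⟨ deg-E w ⟩
        deg C w + (δ w u ▸ 1 + δ w v ▸ 1)    ≡⟨ cong₂ (λ a b → deg C w + (a ▸ 1 + b ▸ 1)) (δ-≢ (outside-U Uu)) (δ-≢ (outside-U Uv)) ⟩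
        deg C w + 0                          ≡⟨ +-identityʳ (deg C w) ⟩
        deg C w                              ≡⟨ deg-out (∉-false {X = Fu.K} (λ q → outside-U (Fu.K⊆U w q) refl)) (∉-false {X = Fv.K} (λ q → outside-U (Fv.K⊆U w q) refl)) ⟩
        deg H w ∎
        where open ≤-Reasoning

excess : ∀ {n} → Multi n → ℕ
excess m = ∑ (λ x → deg m x ∸ 5)

rerouted : ∀ {n} {g : Multi n} (T : SpanningTight g) {Z} → Reroute g (SpanningTight.graph T) Z → SpanningTight g
rerouted T {Z} R = record
  { graph = R.graph ; sy = R.sy ; sparse = R.sparse ; ≤g = R.≤g
  ; tight = trans (cong (_+ 4) (agree-D Z R.agree R.same {full} (λ _ _ → refl))) (SpanningTight.tight T) }
  where module R = Reroute R

boundary-count : ∀ {n} (m : Multi n) → Symm m → ∀ U →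
  D m full + D m (λ x → not (U x)) ≡ D m U + 2 * ∑ (λ x → not (U x) ▸ deg m x)
boundary-count {n} m sy U = begin
  D m full + D m S
    ≡⟨ sym (∑²-+ m (m ↾ S)) ⟩
  ∑² (λ x y → m x y + (m ↾ S) x y)
    ≡⟨ ∑²-cong (λ x y → pt (U x) (U y) (m x y)) ⟩
  ∑² (λ x y → (m ↾ U) x y + (S x ▸ m x y + S y ▸ m x y))
    ≡⟨ trans (∑²-+ (m ↾ U) (λ x y → S x ▸ m x y + S y ▸ m x y)) (cong (D m U +_) (∑²-+ (λ x y → S x ▸ m x y) (λ x y → S y ▸ m x y))) ⟩
  D m U + (∑² (λ x y → S x ▸ m x y) + ∑² (λ x y → S y ▸ m x y))
    ≡⟨ cong (D m U +_) (cong₂ _+_ rows (trans (∑-swap (λ x y → S y ▸ m x y)) (trans (∑²-cong (λ y x → cong (S y ▸_) (sy x y))) rows))) ⟩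
  D m U + (∑ (λ x → S x ▸ deg m x) + ∑ (λ x → S x ▸ deg m x))
    ≡⟨ cong (λ k → D m U + (∑ (λ x → S x ▸ deg m x) + k)) (sym (+-identityʳ _)) ⟩
  D m U + 2 * ∑ (λ x → S x ▸ deg m x) ∎
  where
  open ≡-Reasoning
  S : Sub n
  S x = not (U x)
  rows : ∑² (λ x y → S x ▸ m x y) ≡ ∑ (λ x → S x ▸ deg m x)
  rows = ∑-cong (λ x → ∑-▸ (S x) (m x))
  pt : ∀ a b k → k + (not a ∧ not b) ▸ k ≡ (a ∧ b) ▸ k + (not a ▸ k + not b ▸ k)
  pt true  true  k = refl
  pt true  false k = +-identityʳ k
  pt false true  k = refl
  pt false false k = refl

module Reduce {n} (g : Multi n) (sg : Symm g) (lg : Loopless g) (tg : Tough g) where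

  module Step (T : SpanningTight g) (w₀ : Fin n) (big : 6 ≤ deg (SpanningTight.graph T) w₀) where
    open SpanningTight T renaming (graph to H; sy to sH; sparse to spH; ≤g to H≤g; tight to tH)

    Better : Set
    Better = ∃ λ (T′ : SpanningTight g) → excess (SpanningTight.graph T′) < excess H

    -- Degrees up to 5 do not count in `excess`, so vertices that the exchange raises that far do no
    -- harm.
    relieve : ∀ {Z w} → 6 ≤ deg H w → Relief g H Z w → Better
    relieve {Z} {w} bw L = rerouted T L.reroute , ∑-strict (λ x → mono x (L.bound x)) w (strict (≤-total 5 (deg E w)))
      where
      module L = Relief L
      E = Reroute.graph L.reroute
      mono : ∀ x → deg E x ≤ 5 ⊎ deg E x ≤ deg H x → deg E x ∸ 5 ≤ deg H x ∸ 5
      mono x (inj₁ le) = ≤-trans (≤-reflexive (m≤n⇒m∸n≡0 le)) z≤n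
      mono x (inj₂ le) = ∸-monoˡ-≤ 5 le
      strict : 5 ≤ deg E w ⊎ deg E w ≤ 5 → deg E w ∸ 5 < deg H w ∸ 5
      strict (inj₁ ge) = ∸-monoˡ-< L.drop ge
      strict (inj₂ le) = ≤-<-trans (≤-reflexive (m≤n⇒m∸n≡0 le)) (m<n⇒0<n∸m bw)

    -- In edges: `H` has 2n - 2, the complement S spans at most 2|S| - 2 and has degree sum at least
    -- 5|S|; hence `U` spans at most 2|U| - |S| - 4, two fewer than `sparse-bound` demands. The
    -- vertex `w₀` makes S nonempty, so that sparsity applies to it.
    saturated : ∀ U → (∀ x → U x ≡ true → deg H x ≤ 5) → (∀ x → U x ≡ false → 5 ≤ deg H x) →
      ¬ (∀ u v → U u ≡ true → U v ≡ true → H u v ≡ g u v ⊎ ∃ (TightOn H U u v))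
    saturated U small large dich = arith (size U) (cosize U) (D H full) (D H U) (D H S) (∑ (λ x → S x ▸ deg H x)) (boundary-count H sH U)
      (trans tH (cong (4 *_) (trans (size-full n) (sym (size-cosize U)))))
      (spH S w₀ (not-false w₀∉U)) large-sum (sparse-bound g sg lg tg H spH H≤g U dich)
      where
      S : Sub n
      S x = not (U x)
      w₀∉U : U w₀ ≡ false
      w₀∉U = ∉-false {X = U} (λ p → <⇒≱ big (small w₀ p))
      large-sum : 5 * cosize U ≤ ∑ (λ x → S x ▸ deg H x)
      large-sum = ≤-trans (≤-reflexive (sym (∑-* 5 (λ x → S x ▸ 1)))) (∑-mono λ x → pt x (bool (U x)))
        where
        pt : ∀ x → U x ≡ true ⊎ U x ≡ false → 5 * (S x ▸ 1) ≤ S x ▸ deg H x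
        pt x (inj₁ p) rewrite p = z≤n
        pt x (inj₂ p) rewrite p = large x p
      arith : ∀ u s dV dU dS t → dV + dS ≡ dU + 2 * t → dV + 4 ≡ 4 * (u + s) → dS + 4 ≤ 4 * s → 5 * s ≤ t →
        4 * u ≤ dU + 2 * s + 4 → ⊥
      arith u s dV dU dS t h₁ h₂ h₃ h₄ h₅ = 4≰0 (lin 0
        (+-mono-≤ (≤-reflexive (sym h₁)) (+-mono-≤ (≤-reflexive h₂) (+-mono-≤ h₃ (+-mono-≤ (scale 2 h₄) h₅))))
        (solve (u ∷ s ∷ dV ∷ dU ∷ dS ∷ t ∷ [])))
        where
        4≰0 : ¬ (4 ≤ 0)
        4≰0 ()

    -- By `saturated`, `U` always contains a pair to which `augment` applies. The resulting set `Z`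
    -- either has a vertex of degree at least 6 outside `U`, which can be relieved, or makes `U`
    -- grow.
    search : ∀ k U → cosize U ≤ k → (∀ u → U u ≡ true → Flexible g H U u) → (∀ x → U x ≡ true → deg H x ≤ 5) →
      (∀ x → U x ≡ false → 5 ≤ deg H x) → Better
    search k U le flex small large =
      expand (any? (λ u → any? (λ v → (U u Bool.≟ true) ×-dec (U v Bool.≟ true) ×-dec (H u v <? g u v) ×-dec ¬? (anyTight? H U u v))))
      where
      expand : Dec (∃ λ u → ∃ λ v → U u ≡ true × U v ≡ true × H u v < g u v × ¬ ∃ (TightOn H U u v)) → Better
      expand (no none) = ⊥-elim (saturated U small large λ u v Uu Uv → dich u v Uu Uv (anyTight? H U u v))
        where
        dich : ∀ u v → U u ≡ true → U v ≡ true → Dec (∃ (TightOn H U u v)) → H u v ≡ g u v ⊎ ∃ (TightOn H U u v)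
        dich u v Uu Uv (yes t) = inj₂ t
        dich u v Uu Uv (no ¬t) = inj₁ (≤-antisym (H≤g u v) (≮⇒≥ λ lt → none (u , v , Uu , Uv , lt , ¬t)))
      expand (yes (u , v , Uu , Uv , lt , ¬t)) = enlarge (augment sg lg T U u v Uu Uv (flex u Uu) (flex v Uv) lt ¬t)
        where
        enlarge : (∃ λ Z → Tight H Z × Z u ≡ true × Z v ≡ true × (∀ w → Z w ≡ true → U w ≡ false → Relief g H Z w)) → Better
        enlarge (Z , tZ , Zu , Zv , relief) =
          inspect (any? (λ w → (Z w Bool.≟ true) ×-dec (U w Bool.≟ false) ×-dec (6 ≤? deg H w)))
            (any? (λ w → (Z w Bool.≟ true) ×-dec (U w Bool.≟ false)))
          where
          inspect : Dec (∃ λ w → Z w ≡ true × U w ≡ false × 6 ≤ deg H w) → Dec (∃ λ w → Z w ≡ true × U w ≡ false) → Better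
          inspect (yes (w , Zw , ¬Uw , bw)) _ = relieve bw (relief w Zw ¬Uw)
          inspect (no _) (no Z⊆U) = ⊥-elim (¬t (Z , tZ , sub , Zu , Zv))
            where
            sub : Z ⊆ U
            sub x p with bool (U x)
            ... | inj₁ q = q
            ... | inj₂ q = ⊥-elim (Z⊆U (x , p , q))
          -- All vertices of `Z` outside `U` have degree exactly 5 here. The relief of such a vertex
          -- takes it to at most 4 within the tight set `Z`, so it is flexible in `U ∪ Z`.
          inspect (no none) (yes (w , Zw , ¬Uw)) = continue k le
            where
            U′ : Sub n
            U′ = U ∪ Z
            fewer : cosize U′ < cosize U
            fewer = size-⊂ {X = λ x → not (U′ x)} {Y = λ x → not (U x)} (λ x → co (U x)) w (not-false ¬Uw) (cong not (∨-introʳ {U w} Zw))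
              where
              co : ∀ a {b} → not (a ∨ b) ≡ true → not a ≡ true
              co false _ = refl
            small′ : ∀ x → U′ x ≡ true → deg H x ≤ 5
            small′ x p with bool (U x) | ∨-true {U x} p
            ... | inj₁ q | _      = small x q
            ... | inj₂ q | inj₁ r = small x r
            ... | inj₂ q | inj₂ r = ≤-pred (≰⇒> λ b → none (x , r , q , b))
            large′ : ∀ x → U′ x ≡ false → 5 ≤ deg H x
            large′ x p = large x (∉-false {X = U} (λ q → true≢false (∨-introˡ q) p))
            flex′ : ∀ x → U′ x ≡ true → Flexible g H U′ x
            flex′ x p = at (bool (U x))
              where
              at : U x ≡ true ⊎ U x ≡ false → Flexible g H U′ x
              at (inj₁ q) = record { K = F.K ; K⊆U = λ y r → ∨-introˡ (F.K⊆U y r) ; K∋ = F.K∋ ; tight = F.tight ; reroute = F.reroute ; low = F.low ; bound = F.bound }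
                where module F = Flexible (flex x q)
              at (inj₂ q) = record { K = Z ; K⊆U = λ y → ∨-introʳ {U y} ; K∋ = Zx ; tight = tZ ; reroute = L.reroute
                                   ; low = ≤-pred (≤-trans L.drop (small′ x p)) ; bound = λ y Zy → cap y Zy (L.bound y) }
                where
                Zx : Z x ≡ true
                Zx with ∨-true {U x} p
                ... | inj₁ r = true≢false r q
                ... | inj₂ r = r
                module L = Relief (relief x Zx q)
                cap : ∀ y → Z y ≡ true → deg (Reroute.graph L.reroute) y ≤ 5 ⊎ deg (Reroute.graph L.reroute) y ≤ deg H y → deg (Reroute.graph L.reroute) y ≤ 5
                cap y Zy (inj₁ b) = b
                cap y Zy (inj₂ b) = ≤-trans b (small′ y (∨-introʳ {U y} Zy))
            continue : ∀ k → cosize U ≤ k → Better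
            continue zero    le = ⊥-elim (n≮0 (≤-trans fewer le))
            continue (suc k) le = search k U′ (≤-pred (≤-trans fewer le)) flex′ small′ large′

    improve : Better
    improve = search (cosize U) U ≤-refl flex (λ x p → ≤-trans (low x p) (n≤1+n 4)) (λ x p → ≰⇒> (high x p))
      where
      -- The initial vertices already have room for an edge: nothing is rerouted, and a singleton
      -- serves as the tight set.
      U : Sub n
      U x = does (deg H x ≤? 4)
      low : ∀ x → U x ≡ true → deg H x ≤ 4
      low x = does⇒ (deg H x ≤? 4)
      high : ∀ x → U x ≡ false → ¬ deg H x ≤ 4
      high x p le = true≢false (dec-true (deg H x ≤? 4) le) p
      only : ∀ u {x} → single u x ≡ true → x ≡ u
      only u {x} = δ⇒≡ x u
      flex : ∀ u → U u ≡ true → Flexible g H U u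
      flex u p = record
        { K = single u ; K⊆U = λ x q → subst (λ y → U y ≡ true) (sym (only u q)) p ; K∋ = δ-refl u
        ; tight = tight-single H u (n≤0⇒n≡0 (subst (H u u ≤_) (lg u) (H≤g u u)))
        ; reroute = record { graph = H ; sy = sH ; sparse = spH ; ≤g = H≤g ; agree = λ _ _ _ → refl ; same = refl }
        ; low = low u p
        ; bound = λ x q → subst (λ y → deg H y ≤ 5) (sym (only u q)) (≤-trans (low u p) (n≤1+n 4)) }

  reduce : ∀ k (T : SpanningTight g) → excess (SpanningTight.graph T) ≤ k →
    ∃ λ (T′ : SpanningTight g) → ∀ x → deg (SpanningTight.graph T′) x ≤ 5
  reduce k T le = decide k le (any? (λ w → 6 ≤? deg (SpanningTight.graph T) w))
    where
    continue : ∀ k → excess (SpanningTight.graph T) ≤ k → (∃ λ (T′ : SpanningTight g) → excess (SpanningTight.graph T′) < excess (SpanningTight.graph T)) →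
      ∃ λ (T′ : SpanningTight g) → ∀ x → deg (SpanningTight.graph T′) x ≤ 5
    continue zero    le (T′ , lt) = ⊥-elim (n≮0 (≤-trans lt le))
    continue (suc k) le (T′ , lt) = reduce k T′ (≤-pred (≤-trans lt le))
    decide : ∀ k → excess (SpanningTight.graph T) ≤ k → Dec (∃ λ w → 6 ≤ deg (SpanningTight.graph T) w) →
      ∃ λ (T′ : SpanningTight g) → ∀ x → deg (SpanningTight.graph T′) x ≤ 5
    decide k le (no none)     = T , λ x → ≤-pred (≰⇒> λ b → none (x , b))
    decide k le (yes (w , b)) = continue k le (Step.improve T w b)

-- Decomposition into two connected spanning subgraphs

Joined : ∀ {n} → Multi n → Fin n → Fin n → Set
Joined A = Reach A Subset.⊥

edge : ∀ {n} {A : Multi n} {u v} → 0 < A u v → Joined A u v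
edge e = step ∉⊥ ∉⊥ e (here ∉⊥)

joined-map : ∀ {n} {A B : Multi n} → (∀ x y → 0 < A x y → Joined B x y) → ∀ {u v} → Joined A u v → Joined B u v
joined-map f (here p)       = here p
joined-map f (step _ _ e r) = reach-trans (f _ _ e) (joined-map f r)

Connects : ∀ {n} → Multi n → Sub n → Set
Connects A X = ∀ u v → X u ≡ true → X v ≡ true → Joined A u v

connects-via : ∀ {n} {A : Multi n} {X} r → Symm A → (∀ u → X u ≡ true → Joined A u r) → Connects A X
connects-via r sA f u v p q = reach-trans (f u p) (reach-sym sA (f v q))

connects-extend : ∀ {n} {A A′ : Multi n} {X} v a → Symm A → (∀ x y → 0 < A′ x y → Joined A x y) → Joined A v a →
  (X - v) a ≡ true → Connects A′ (X - v) → Connects A X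
connects-extend {A = A} {X = X} v a sA f va X′a conn = connects-via a sA λ u p → reach u p (u ≟ v)
  where
  reach : ∀ u → X u ≡ true → Dec (u ≡ v) → Joined A u a
  reach u p (yes refl) = va
  reach u p (no ne)    = joined-map f (conn u a (-intro {X = X} p ne) X′a)

record TwoConnectors {n : ℕ} (m : Multi n) (X : Sub n) : Set where
  field
    A B  : Multi n
    sA   : Symm A
    sB   : Symm B
    A+B≤ : ∀ x y → A x y + B x y ≤ m x y
    cA   : Connects A X
    cB   : Connects B X

-- Takes one unit off a multiplicity function. Repeated, it lists the edges at a vertex one by one,
-- parallel ones included.
extract : ∀ {n} (f : Fin n → ℕ) k → suc k ≤ ∑ f →
  ∃ λ a → Σ (Fin n → ℕ) λ f′ → (∀ y → f y ≡ δ y a ▸ 1 + f′ y) × k ≤ ∑ f′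
extract f k le with ∑-pos f (≤-trans (s≤s z≤n) le)
... | a , pos = a , f′ , eq , ≤-pred (≤-trans le (≤-reflexive sum))
  where
  f′ : _ → ℕ
  f′ y = f y ∸ δ y a ▸ 1
  eq : ∀ y → f y ≡ δ y a ▸ 1 + f′ y
  eq y = sym (m+[n∸m]≡n (at (y ≟ a)))
    where
    at : Dec (y ≡ a) → δ y a ▸ 1 ≤ f y
    at (yes refl) rewrite δ-refl y = pos
    at (no ne)    rewrite δ-≢ ne = z≤n
  sum : ∑ f ≡ suc (∑ f′)
  sum = trans (∑-cong eq) (trans (∑-+ (λ y → δ y a ▸ 1) f′) (cong (_+ ∑ f′) (∑-δ a (λ _ → 1))))

star : ∀ {n} → Fin n → (Fin n → ℕ) → Multi n
star v h x y = δ x v ▸ h y + δ y v ▸ h x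

star-δ : ∀ {n} (v a : Fin n) x y → star v (λ z → δ z a ▸ 1) x y ≡ Ed v a x y
star-δ v a x y = cong₂ _+_ (pt (δ x v) (δ y a)) (pt′ (δ y v) (δ x a))
  where
  pt : ∀ a b → a ▸ (b ▸ 1) ≡ (a ∧ b) ▸ 1
  pt true  b = refl
  pt false b = refl
  pt′ : ∀ a b → a ▸ (b ▸ 1) ≡ (b ∧ a) ▸ 1
  pt′ true  true  = refl
  pt′ true  false = refl
  pt′ false true  = refl
  pt′ false false = refl

star-+ : ∀ {n} (v : Fin n) h k x y → star v (λ z → h z + k z) x y ≡ star v h x y + star v k x y
star-+ v h k x y rewrite ▸-+ (δ x v) (h y) (k y) | ▸-+ (δ y v) (h x) (k x) =
  shuffle (δ x v ▸ h y) (δ x v ▸ k y) (δ y v ▸ h x) (δ y v ▸ k x)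
  where
  shuffle : ∀ a b c d → a + b + (c + d) ≡ a + c + (b + d)
  shuffle = solve-∀

star-mono : ∀ {n} (v : Fin n) {h k : Fin n → ℕ} → (∀ y → h y ≤ k y) → ∀ x y → star v h x y ≤ star v k x y
star-mono v le x y = +-mono-≤ (▸-monoʳ (δ x v) (λ _ → le y)) (▸-monoʳ (δ y v) (λ _ → le x))

star-≤ : ∀ {n} {m : Multi n} → Symm m → Loopless m → ∀ X v x y →
  (m ↾ (X - v)) x y + star v (λ z → X z ▸ m v z) x y ≤ m x y
star-≤ {n} {m} sy ll X v x y = at (x ≟ v) (y ≟ v)
  where
  f : Fin n → ℕ
  f z = X z ▸ m v z
  f-v : X v ▸ m v v ≡ 0
  f-v = n≤0⇒n≡0 (≤-trans (▸-≤ (X v) (m v v)) (≤-reflexive (ll v)))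
  out : (X - v) v ≡ false
  out = trans (cong (λ b → X v ∧ not b) (δ-refl v)) (Bool.∧-zeroʳ (X v))
  at : Dec (x ≡ v) → Dec (y ≡ v) → (m ↾ (X - v)) x y + star v f x y ≤ m x y
  at (yes refl) (yes refl) rewrite out | δ-refl x | f-v = z≤n
  at (yes refl) (no q) rewrite out | δ-refl x | δ-≢ q = ≤-trans (≤-reflexive (+-identityʳ _)) (▸-≤ (X y) (m x y))
  at (no p) (yes refl) rewrite out | δ-refl y | δ-≢ p | Bool.∧-zeroʳ (X x ∧ true) =
    ≤-trans (▸-≤ (X x) (m y x)) (≤-reflexive (sy y x))
  at (no p) (no q) rewrite δ-≢ p | δ-≢ q = ≤-trans (≤-reflexive (+-identityʳ _)) (▸-≤ ((X x ∧ true) ∧ (X y ∧ true)) (m x y))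

-- Henneberg moves backwards: a vertex v of degree 2 is deleted; a vertex of
-- degree 3 is deleted and an edge pq between two of its neighbours is added.
module Henneberg {n} {m : Multi n} (sy : Symm m) (ll : Loopless m) (sp : Sparse m) (X : Sub n) (v : Fin n) where

  X′ : Sub n
  X′ = X - v

  r : Multi n
  r = m ↾ X′

  r≤m : ∀ x y → r x y ≤ m x y
  r≤m x y = ▸-≤ (X′ x ∧ X′ y) (m x y)

  sr : Symm r
  sr = ↾-sym X′ sy

  lr : Loopless r
  lr x = n≤0⇒n≡0 (≤-trans (r≤m x x) (≤-reflexive (ll x)))

  spr : Sparse r
  spr = sparse-mono r≤m sp

  D-r : D r X′ ≡ D m X′
  D-r = ∑²-cong λ x y → idem (X′ x ∧ X′ y) (m x y)
    where
    idem : ∀ b k → b ▸ (b ▸ k) ≡ b ▸ k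
    idem true  k = refl
    idem false k = refl

  neighbour : ∀ {a} {f : Fin n → ℕ} → (∀ y → δ y a ▸ 1 + f y ≤ X y ▸ m v y) → X′ a ≡ true
  neighbour {a} {f} le = -intro {X = X} (Xa (X a) refl) λ { refl → n≮0 (≤-trans pos (≤-trans (▸-≤ (X a) (m a a)) (≤-reflexive (ll a)))) }
    where
    pos : 0 < X a ▸ m v a
    pos = ≤-trans (≤-trans (≤-reflexive (cong (_▸ 1) (sym (δ-refl a)))) (m≤m+n _ (f a))) (le a)
    Xa : ∀ b → X a ≡ b → X a ≡ true
    Xa true  p = p
    Xa false p = ⊥-elim (n≮0 (subst (λ b → 0 < b ▸ m v a) p pos))

  -- The vertex `v` becomes a leaf of both connectors, with one of its edges in each.
  attach : ∀ {a b} → X′ a ≡ true → X′ b ≡ true → (∀ x y → r x y + (Ed v a x y + Ed v b x y) ≤ m x y) →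
    (T : TwoConnectors r X′) → TwoConnectors m X
  attach {a} {b} X′a X′b le T = record
    { A = A′ ; B = B′ ; sA = sA′ ; sB = sB′
    ; A+B≤ = λ x y → ≤-trans (≤-reflexive (shuffle (T.A x y) (Ed v a x y) (T.B x y) (Ed v b x y))) (≤-trans (+-monoˡ-≤ (Ed v a x y + Ed v b x y) (T.A+B≤ x y)) (le x y))
    ; cA = connects-extend v a sA′ (λ x y e → edge (≤-trans e (m≤m+n _ _))) (edge (≤-trans (Ed-self v a) (m≤n+m (Ed v a v a) (T.A v a)))) X′a T.cA
    ; cB = connects-extend v b sB′ (λ x y e → edge (≤-trans e (m≤m+n _ _))) (edge (≤-trans (Ed-self v b) (m≤n+m (Ed v b v b) (T.B v b)))) X′b T.cB }
    where
    module T = TwoConnectors T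
    A′ B′ : Multi n
    A′ x y = T.A x y + Ed v a x y
    B′ x y = T.B x y + Ed v b x y
    sA′ : Symm A′
    sA′ = add-sym T.sA v a
    sB′ : Symm B′
    sB′ = add-sym T.sB v b
    shuffle : ∀ a b c d → a + b + (c + d) ≡ a + c + (b + d)
    shuffle = solve-∀

  -- The edge pq of the first connector becomes the path p v q, and the third edge at `v` hangs `v`
  -- on the second.
  subdivide : ∀ {p q s} → p ≢ q → X′ p ≡ true → X′ s ≡ true →
    (∀ x y → r x y + (Ed v p x y + (Ed v q x y + Ed v s x y)) ≤ m x y) →
    (T : TwoConnectors (λ x y → r x y + Ed p q x y) X′) → 0 < TwoConnectors.A T p q → TwoConnectors m X
  subdivide {p} {q} {s} p≢q X′p X′s le T pos = record
    { A = A′ ; B = B′ ; sA = sA′ ; sB = sB′ ; A+B≤ = bound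
    ; cA = connects-extend v p sA′ reroute vp X′p T.cA
    ; cB = connects-extend v s sB′ (λ x y e → edge (≤-trans e (m≤m+n _ _))) (edge (≤-trans (Ed-self v s) (m≤n+m (Ed v s v s) (T.B v s)))) X′s T.cB }
    where
    module T = TwoConnectors T
    A′ B′ : Multi n
    A′ x y = (T.A x y ∸ Ed p q x y) + (Ed v p x y + Ed v q x y)
    B′ x y = T.B x y + Ed v s x y
    sA′ : Symm A′
    sA′ x y = cong₂ _+_ (cong₂ _∸_ (T.sA x y) (Ed-sym p q x y)) (cong₂ _+_ (Ed-sym v p x y) (Ed-sym v q x y))
    sB′ : Symm B′
    sB′ = add-sym T.sB v s
    vp : Joined A′ v p
    vp = edge (≤-trans (Ed-self v p) (≤-trans (m≤m+n _ (Ed v q v p)) (m≤n+m _ (T.A v p ∸ Ed p q v p))))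
    vq : Joined A′ v q
    vq = edge (≤-trans (Ed-self v q) (≤-trans (m≤n+m _ (Ed v p v q)) (m≤n+m _ (T.A v q ∸ Ed p q v q))))
    reroute : ∀ x y → 0 < T.A x y → Joined A′ x y
    reroute x y e = at (x ≟ p) (y ≟ q) (x ≟ q) (y ≟ p)
      where
      keep : ¬ (x ≡ p × y ≡ q) → ¬ (x ≡ q × y ≡ p) → Joined A′ x y
      keep a b = edge (≤-trans (subst (λ k → 0 < T.A x y ∸ k) (sym (Ed-off a b)) e) (m≤m+n _ _))
      at : Dec (x ≡ p) → Dec (y ≡ q) → Dec (x ≡ q) → Dec (y ≡ p) → Joined A′ x y
      at (yes refl) (yes refl) _          _          = reach-trans (reach-sym sA′ vp) vq
      at _          _          (yes refl) (yes refl) = reach-trans (reach-sym sA′ vq) vp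
      at (no a)     _          (no b)     _          = keep (λ e → a (proj₁ e)) (λ e → b (proj₁ e))
      at (no a)     _          _          (no b)     = keep (λ e → a (proj₁ e)) (λ e → b (proj₂ e))
      at _          (no a)     (no b)     _          = keep (λ e → a (proj₂ e)) (λ e → b (proj₁ e))
      at _          (no a)     _          (no b)     = keep (λ e → a (proj₂ e)) (λ e → b (proj₂ e))
    bound : ∀ x y → A′ x y + B′ x y ≤ m x y
    bound x y = ≤-trans (≤-reflexive (shuffle (T.A x y ∸ Ed p q x y) (Ed v p x y) (Ed v q x y) (T.B x y) (Ed v s x y)))
      (≤-trans (+-monoˡ-≤ (Ed v p x y + (Ed v q x y + Ed v s x y)) (+-cancelʳ-≤ (Ed p q x y) (T.A x y ∸ Ed p q x y + T.B x y) (r x y) inner)) (le x y))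
      where
      shuffle : ∀ a b c d e → a + (b + c) + (d + e) ≡ a + d + (b + (c + e))
      shuffle = solve-∀
      inner : T.A x y ∸ Ed p q x y + T.B x y + Ed p q x y ≤ r x y + Ed p q x y
      inner = ≤-trans (≤-reflexive (trans (swap (T.A x y ∸ Ed p q x y) (T.B x y) (Ed p q x y))
        (cong (_+ T.B x y) (m∸n+n≡m (Ed-≤ T.A T.sA p≢q pos x y))))) (T.A+B≤ x y)
        where
        swap : ∀ a b c → a + b + c ≡ a + c + b
        swap = solve-∀

  flip-connectors : ∀ {m : Multi n} {X} → TwoConnectors m X → TwoConnectors m X
  flip-connectors T = record { A = T.B ; B = T.A ; sA = T.sB ; sB = T.sA ; cA = T.cB ; cB = T.cA
    ; A+B≤ = λ x y → ≤-trans (≤-reflexive (+-comm (T.B x y) _)) (T.A+B≤ x y) }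
    where module T = TwoConnectors T

  -- Parallel copies are interchangeable, so the added copy of pq is in use exactly when the
  -- connectors together exceed `r` there, and it may then be charged to either connector that has a
  -- copy. If it is not in use, `v` is attached as a leaf of both.
  split : ∀ {p q s} → p ≢ q → X′ p ≡ true → X′ q ≡ true → X′ s ≡ true →
    (∀ x y → r x y + (Ed v p x y + (Ed v q x y + Ed v s x y)) ≤ m x y) →
    TwoConnectors (λ x y → r x y + Ed p q x y) X′ → TwoConnectors m X
  split {p} {q} {s} p≢q X′p X′q X′s le T = at (T.A p q + T.B p q ≤? r p q)
    where
    module T = TwoConnectors T
    at : Dec (T.A p q + T.B p q ≤ r p q) → TwoConnectors m X
    at (yes small) = attach X′p X′q
      (λ x y → ≤-trans (+-monoʳ-≤ (r x y) (+-monoʳ-≤ (Ed v p x y) (m≤m+n _ _))) (le x y))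
      (record { A = T.A ; B = T.B ; sA = T.sA ; sB = T.sB ; cA = T.cA ; cB = T.cB ; A+B≤ = λ x y → unused x y (x ≟ p) (y ≟ q) (x ≟ q) (y ≟ p) })
      where
      keep : ∀ {x y} → ¬ (x ≡ p × y ≡ q) → ¬ (x ≡ q × y ≡ p) → T.A x y + T.B x y ≤ r x y
      keep {x} {y} a b = ≤-trans (T.A+B≤ x y) (≤-reflexive (trans (cong (r x y +_) (Ed-off a b)) (+-identityʳ _)))
      unused : ∀ x y → Dec (x ≡ p) → Dec (y ≡ q) → Dec (x ≡ q) → Dec (y ≡ p) → T.A x y + T.B x y ≤ r x y
      unused x y (yes refl) (yes refl) _ _ = small
      unused x y _ _ (yes refl) (yes refl) = subst₂ _≤_ (cong₂ _+_ (T.sA p q) (T.sB p q)) (sr p q) small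
      unused x y (no a) _ (no b) _ = keep (λ e → a (proj₁ e)) (λ e → b (proj₁ e))
      unused x y (no a) _ _ (no b) = keep (λ e → a (proj₁ e)) (λ e → b (proj₂ e))
      unused x y _ (no a) (no b) _ = keep (λ e → a (proj₂ e)) (λ e → b (proj₁ e))
      unused x y _ (no a) _ (no b) = keep (λ e → a (proj₂ e)) (λ e → b (proj₂ e))
    at (no large) with T.A p q in eq
    ... | suc _ = subdivide p≢q X′p X′s le T (subst (0 <_) (sym eq) (s≤s z≤n))
    ... | zero  = subdivide p≢q X′p X′s le (flip-connectors T) (≤-trans (s≤s z≤n) (≰⇒> large))

-- Deleting `v` takes twice its degree off `D` and 4 off the bound. Degree 2 thus leaves a tight
-- set, and degree 3 a set short of one edge. Smaller degrees are excluded by `tight-degree`.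
remove-vertex : ∀ {n} {m : Multi n} → Symm m → Loopless m → Sparse m → ∀ {X} → Tight m X → ∀ v w → X v ≡ true → (X - v) w ≡ true →
  ∑ (λ y → X y ▸ m v y) ≤ 3 →
  (∀ m′ → Symm m′ → Loopless m′ → Sparse m′ → Tight m′ (X - v) → TwoConnectors m′ (X - v)) → TwoConnectors m X
remove-vertex {n} {m} sy ll sp {X} t v w Xv X′w d≤3 rec = cases (3 ≤? d)
  where
  open Henneberg sy ll sp X v
  f : Fin n → ℕ
  f y = X y ▸ m v y
  d = ∑ f
  2≤d : 2 ≤ d
  2≤d = tight-degree sy ll sp {X} v w t Xv (-⊆ {X = X} {v} w X′w) (-≢ {X = X} {v} X′w)
  r-count : D r X′ + 2 * d + 4 ≡ 4 * size X′ + 4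
  r-count = begin
    D r X′ + 2 * d + 4   ≡⟨ cong (λ k → k + 2 * d + 4) D-r ⟩
    D m X′ + 2 * d + 4   ≡⟨ cong (_+ 4) (sym (D-remove m sy ll X v Xv)) ⟩
    D m X + 4            ≡⟨ trans t (cong (4 *_) (size-remove X v Xv)) ⟩
    4 * (size X′ + 1)    ≡⟨ *-distribˡ-+ 4 (size X′) 1 ⟩
    4 * size X′ + 4      ∎
    where open ≡-Reasoning
  star-f : ∀ {h} → (∀ y → h y ≤ f y) → ∀ x y → r x y + star v h x y ≤ m x y
  star-f le x y = ≤-trans (+-monoʳ-≤ (r x y) (star-mono v le x y)) (star-≤ sy ll X v x y)

  two : ¬ 3 ≤ d → (∃ λ a → Σ (Fin n → ℕ) λ f₁ → (∀ y → f y ≡ δ y a ▸ 1 + f₁ y) × 1 ≤ ∑ f₁) → TwoConnectors m X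
  two d≱3 (a , f₁ , e₁ , le₁) with extract f₁ 0 le₁
  ... | b , f₂ , e₂ , _ = attach
      (neighbour {a} {f₁} (λ y → ≤-reflexive (sym (e₁ y))))
      (neighbour {b} {f₂} (λ y → ≤-trans (≤-reflexive (sym (e₂ y))) (≤-trans (m≤n+m (f₁ y) (δ y a ▸ 1)) (≤-reflexive (sym (e₁ y))))))
      (λ x y → ≤-trans (≤-reflexive (cong (r x y +_) (sym (trans (star-+ v (λ z → δ z a ▸ 1) (λ z → δ z b ▸ 1) x y) (cong₂ _+_ (star-δ v a x y) (star-δ v b x y))))))
        (star-f (λ z → ≤-trans (+-monoʳ-≤ (δ z a ▸ 1) (≤-trans (m≤m+n _ (f₂ z)) (≤-reflexive (sym (e₂ z))))) (≤-reflexive (sym (e₁ z)))) x y))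
      (rec r sr lr spr (arith (D r X′) d (size X′) (≤-antisym (≤-pred (≰⇒> d≱3)) 2≤d) r-count))
    where
    arith : ∀ k d s → d ≡ 2 → k + 2 * d + 4 ≡ 4 * s + 4 → k + 4 ≡ 4 * s
    arith k d s refl e = +-cancelʳ-≡ 4 (k + 4) (4 * s) e

  three : d ≡ 3 → ∀ a b c → X′ a ≡ true → X′ b ≡ true → X′ c ≡ true →
    (∀ x y → r x y + (Ed v a x y + (Ed v b x y + Ed v c x y)) ≤ m x y) → TwoConnectors m X
  three d≡3 a b c X′a X′b X′c le = choose (anyTight? r full a b) (anyTight? r full b c)
    where
    move : ∀ p q s → X′ p ≡ true → X′ q ≡ true → X′ s ≡ true →
      (∀ x y → r x y + (Ed v p x y + (Ed v q x y + Ed v s x y)) ≤ m x y) → ¬ ∃ (TightOn r full p q) → TwoConnectors m X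
    move p q s X′p X′q X′s le none = split p≢q X′p X′q X′s le (rec (λ x y → r x y + Ed p q x y) (add-sym sr p q)
      (λ x → cong₂ _+_ (lr x) (Ed-loopless p≢q x))
      (sparse-add sr lr spr (λ Y Yp Yq tY → none (Y , tY , (λ _ _ → refl) , Yp , Yq)))
      (trans (cong (_+ 4) (trans (D-+ r (Ed p q) X′) (cong (D r X′ +_) (trans (D-Ed p q X′) (cong (λ b → 2 * (b ▸ 1)) (∧-intro X′p X′q))))))
        (arith (D r X′) d (size X′) d≡3 r-count)))
      where
      -- Parallel edges at `v` may list a neighbour twice, but a singleton is tight, so such a pair
      -- is never the one chosen.
      p≢q : p ≢ q
      p≢q refl = none (single p , tight-single r p (lr p) , (λ _ _ → refl) , δ-refl p , δ-refl p)
      arith : ∀ k d s → d ≡ 3 → k + 2 * d + 4 ≡ 4 * s + 4 → k + 2 + 4 ≡ 4 * s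
      arith k d s refl e = trans (+-assoc k 2 4) (+-cancelʳ-≡ 4 (k + 6) (4 * s) e)
    rotate : ∀ x y → r x y + (Ed v b x y + (Ed v c x y + Ed v a x y)) ≤ m x y
    rotate x y = ≤-trans (≤-reflexive (shuffle (r x y) (Ed v a x y) (Ed v b x y) (Ed v c x y))) (le x y)
      where
      shuffle : ∀ k a b c → k + (b + (c + a)) ≡ k + (a + (b + c))
      shuffle = solve-∀
    -- Tight sets through a, b and through b, c would make their union,
    -- together with v, span too many edges.
    choose : Dec (∃ (TightOn r full a b)) → Dec (∃ (TightOn r full b c)) → TwoConnectors m X
    choose (no none) _ = move a b c X′a X′b X′c le none
    choose (yes _) (no none) = move b c a X′b X′c X′a rotate none
    choose (yes (Y , tY , _ , Ya , Yb)) (yes (Z , tZ , _ , Zb , Zc)) =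
      ⊥-elim (arith (D r W) (D r Wv) (D m Wv) (size W) (size Wv) (proj₁ (tight-∪∩ spr b Yb Zb tY tZ))
        (D-mono {m = r} {X = W} {Y = Wv} (λ _ _ → ≤-refl) (λ x → ∨-introˡ)) three-edges (sp Wv v (∨-introʳ {W v} (δ-refl v)))
        (≤-trans (size-∪≤ W (single v)) (≤-reflexive (cong (size W +_) (size-single v)))))
      where
      W Wv : Sub n
      W  = Y ∪ Z
      Wv = W ∪ single v
      E : Multi n
      E x y = Ed v a x y + (Ed v b x y + Ed v c x y)
      one : ∀ {z} → W z ≡ true → D (Ed v z) Wv ≡ 2
      one {z} p = trans (D-Ed v z Wv) (cong (λ k → 2 * (k ▸ 1)) (∧-intro (∨-introʳ {W v} (δ-refl v)) (∨-introˡ p)))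
      three-edges : D r Wv + 6 ≤ D m Wv
      three-edges = ≤-trans (≤-reflexive (trans (cong (D r Wv +_) (sym (trans (D-+ (Ed v a) (λ x y → Ed v b x y + Ed v c x y) Wv)
        (cong₂ _+_ (one (∨-introˡ Ya)) (trans (D-+ (Ed v b) (Ed v c) Wv) (cong₂ _+_ (one (∨-introˡ Yb)) (one (∨-introʳ {Y c} Zc)))))))) (sym (D-+ r E Wv))))
        (D-mono {X = Wv} le (λ _ p → p))
      arith : ∀ k l e s s′ → k + 4 ≡ 4 * s → k ≤ l → l + 6 ≤ e → e + 4 ≤ 4 * s′ → s′ ≤ s + 1 → ⊥
      arith k l e s s′ h₁ h₂ h₃ h₄ h₅ = 2≰0 (lin 0 (+-mono-≤ (≤-reflexive (sym h₁)) (+-mono-≤ h₂ (+-mono-≤ h₃ (+-mono-≤ h₄ (scale 4 h₅)))))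
        (solve (k ∷ l ∷ e ∷ s ∷ s′ ∷ [])))
        where
        2≰0 : ¬ (2 ≤ 0)
        2≰0 ()

  three′ : 3 ≤ d → (∃ λ a → Σ (Fin n → ℕ) λ f₁ → (∀ y → f y ≡ δ y a ▸ 1 + f₁ y) × 2 ≤ ∑ f₁) → TwoConnectors m X
  three′ 3≤d (a , f₁ , e₁ , le₁) with extract f₁ 1 le₁
  ... | b , f₂ , e₂ , le₂ with extract f₂ 0 le₂
  ...   | c , f₃ , e₃ , _ = three (≤-antisym d≤3 3≤d) a b c
      (neighbour {a} {f₁} (λ y → ≤-reflexive (sym (e₁ y))))
      (neighbour {b} {f₂} (λ y → ≤-trans (≤-reflexive (sym (e₂ y))) (f₁≤f y)))
      (neighbour {c} {f₃} (λ y → ≤-trans (≤-reflexive (sym (e₃ y))) (≤-trans (≤-trans (m≤n+m (f₂ y) (δ y b ▸ 1)) (≤-reflexive (sym (e₂ y)))) (f₁≤f y))))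
      (λ x y → ≤-trans (≤-reflexive (cong (r x y +_) (sym (trans (star-+ v (λ z → δ z a ▸ 1) (λ z → δ z b ▸ 1 + δ z c ▸ 1) x y)
          (cong₂ _+_ (star-δ v a x y) (trans (star-+ v (λ z → δ z b ▸ 1) (λ z → δ z c ▸ 1) x y) (cong₂ _+_ (star-δ v b x y) (star-δ v c x y))))))))
        (star-f below x y))
    where
    f₁≤f : ∀ y → f₁ y ≤ f y
    f₁≤f y = ≤-trans (m≤n+m (f₁ y) (δ y a ▸ 1)) (≤-reflexive (sym (e₁ y)))
    below : ∀ z → δ z a ▸ 1 + (δ z b ▸ 1 + δ z c ▸ 1) ≤ f z
    below z = ≤-trans (+-monoʳ-≤ (δ z a ▸ 1) (≤-trans (+-monoʳ-≤ (δ z b ▸ 1) (≤-trans (m≤m+n _ (f₃ z)) (≤-reflexive (sym (e₃ z))))) (≤-reflexive (sym (e₂ z)))))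
      (≤-reflexive (sym (e₁ z)))

  cases : Dec (3 ≤ d) → TwoConnectors m X
  cases (yes 3≤d) = three′ 3≤d (extract f 2 3≤d)
  cases (no d≱3)  = two d≱3 (extract f 1 2≤d)

-- The average degree inside a tight set is below 4, so some vertex has at most three edges there
-- and can be removed, until one vertex is left.
connectors : ∀ {n} k (m : Multi n) X u → size X ≤ k → X u ≡ true → Symm m → Loopless m → Sparse m → Tight m X → TwoConnectors m X
connectors zero m X u le Xu sy ll sp t = ⊥-elim (n≮0 (≤-trans (size-pos X u Xu) le))
connectors {n} (suc k) m X u le Xu sy ll sp t = find (any? (λ v → (X v Bool.≟ true) ×-dec (∑ (λ y → X y ▸ m v y) ≤? 3)))
  where
  find : Dec (∃ λ v → X v ≡ true × ∑ (λ y → X y ▸ m v y) ≤ 3) → TwoConnectors m X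
  find (no none) = ⊥-elim (<⇒≱ (m<m+n (D m X) (s≤s z≤n)) (≤-trans (≤-reflexive t) crowded))
    where
    crowded : 4 * size X ≤ D m X
    crowded = ≤-trans (≤-reflexive (sym (∑-* 4 (λ x → X x ▸ 1)))) (≤-trans (∑-mono (λ x → pt x (bool (X x)))) (≤-reflexive (sym (D-rows m X))))
      where
      pt : ∀ x → X x ≡ true ⊎ X x ≡ false → 4 * (X x ▸ 1) ≤ X x ▸ ∑ (λ y → X y ▸ m x y)
      pt x (inj₁ p) = subst (λ b → 4 * (b ▸ 1) ≤ b ▸ ∑ (λ y → X y ▸ m x y)) (sym p) (≰⇒> (λ q → none (x , p , q)))
      pt x (inj₂ p) = subst (λ b → 4 * (b ▸ 1) ≤ b ▸ ∑ (λ y → X y ▸ m x y)) (sym p) z≤n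
  find (yes (v , Xv , d≤3)) = next (any? (λ w → (X - v) w Bool.≟ true))
    where
    next : Dec (∃ λ w → (X - v) w ≡ true) → TwoConnectors m X
    next (yes (w , X′w)) = remove-vertex sy ll sp {X} t v w Xv X′w d≤3
      (λ m′ → connectors k m′ (X - v) w (≤-pred (≤-trans (≤-reflexive (trans (+-comm 1 (size (X - v))) (sym (size-remove X v Xv)))) le)) X′w)
    next (no alone) = record { A = λ _ _ → 0 ; B = λ _ _ → 0 ; sA = λ _ _ → refl ; sB = λ _ _ → refl ; A+B≤ = λ _ _ → z≤n ; cA = same ; cB = same }
      where
      only : ∀ x → X x ≡ true → x ≡ v
      only x p with x ≟ v
      ... | yes e = e
      ... | no ne = ⊥-elim (alone (x , -intro {X = X} p ne))
      same : Connects (λ _ _ → 0) X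
      same x y p q with only x p | only y q
      ... | refl | refl = here ∉⊥

-- Parity

⨁ : ∀ {n} → (Fin n → Bool) → Bool
⨁ {zero}  f = false
⨁ {suc n} f = f Fin.zero xor ⨁ (λ i → f (Fin.suc i))

⨁-cong : ∀ {n} {f g : Fin n → Bool} → (∀ i → f i ≡ g i) → ⨁ f ≡ ⨁ g
⨁-cong {zero}  e = refl
⨁-cong {suc n} e = cong₂ _xor_ (e Fin.zero) (⨁-cong (λ i → e (Fin.suc i)))

⨁-false : ∀ n → ⨁ {n} (λ _ → false) ≡ false
⨁-false zero    = refl
⨁-false (suc n) = ⨁-false n

xor-interchange : ∀ a b c d → (a xor b) xor (c xor d) ≡ (a xor c) xor (b xor d)
xor-interchange true  true  true  d = refl
xor-interchange true  true  false true  = refl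
xor-interchange true  true  false false = refl
xor-interchange true  false true  true  = refl
xor-interchange true  false true  false = refl
xor-interchange true  false false d = refl
xor-interchange false true  true  true  = refl
xor-interchange false true  true  false = refl
xor-interchange false true  false d = refl
xor-interchange false false c     d = refl

⨁-xor : ∀ {n} (f g : Fin n → Bool) → ⨁ (λ i → f i xor g i) ≡ ⨁ f xor ⨁ g
⨁-xor {zero}  f g = refl
⨁-xor {suc n} f g = trans (cong ((f Fin.zero xor g Fin.zero) xor_) (⨁-xor (λ i → f (Fin.suc i)) (λ i → g (Fin.suc i))))
  (xor-interchange (f Fin.zero) (g Fin.zero) _ _)

⨁-swap : ∀ {m n} (f : Fin m → Fin n → Bool) → ⨁ (λ i → ⨁ (f i)) ≡ ⨁ (λ j → ⨁ (λ i → f i j))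
⨁-swap {zero}  {n} f = sym (⨁-false n)
⨁-swap {suc m} f = trans (cong (⨁ (f Fin.zero) xor_) (⨁-swap (λ i → f (Fin.suc i))))
  (sym (⨁-xor (f Fin.zero) (λ j → ⨁ (λ i → f (Fin.suc i) j))))

⨁-∧ : ∀ {n} b (f : Fin n → Bool) → ⨁ (λ i → b ∧ f i) ≡ b ∧ ⨁ f
⨁-∧ true  f = refl
⨁-∧ {n} false f = ⨁-false n

⨁-δ : ∀ {n} (u : Fin n) (f : Fin n → Bool) → ⨁ (λ i → δ i u ∧ f i) ≡ f u
⨁-δ {suc n} Fin.zero    f = trans (cong (f Fin.zero xor_) (⨁-false n)) (Bool.xor-identityʳ (f Fin.zero))
⨁-δ (Fin.suc u) f = ⨁-δ u (λ i → f (Fin.suc i))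

⨁-true : ∀ {n} (f : Fin n → Bool) → ⨁ f ≡ true → ∃ λ i → f i ≡ true
⨁-true {suc n} f p with f Fin.zero in eq
... | true  = Fin.zero , eq
... | false with ⨁-true (λ i → f (Fin.suc i)) p
...   | i , q = Fin.suc i , q

parity : ℕ → Bool
parity zero    = false
parity (suc k) = not (parity k)

parity-+ : ∀ a b → parity (a + b) ≡ parity a xor parity b
parity-+ zero    b = refl
parity-+ (suc a) b rewrite parity-+ a b with parity a
... | true  = Bool.not-involutive (parity b)
... | false = refl

parity-double : ∀ e → parity (2 * e) ≡ false
parity-double e rewrite +-identityʳ e | parity-+ e e = Bool.xor-same (parity e)

parity-∑ : ∀ {n} (f : Fin n → ℕ) → parity (∑ f) ≡ ⨁ (λ i → parity (f i))
parity-∑ {zero}  f = refl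
parity-∑ {suc n} f = trans (parity-+ (f Fin.zero) _) (cong (parity (f Fin.zero) xor_) (parity-∑ (λ i → f (Fin.suc i))))

-- `J` is a T-join in `B`, using at most one edge of each parallel class; `t` is the indicator of T.
BoundaryIs : ∀ {n} → Multi n → (Fin n → Bool) → (Fin n → Fin n → Bool) → Set
BoundaryIs B t J = (∀ x y → J x y ≡ J y x) × (∀ x y → J x y ≡ true → 0 < B x y) × (∀ x → ⨁ (J x) ≡ t x)

-- The edges of a walk are added modulo 2, so the walk may repeat vertices and edges. Inner vertices
-- cancel.
path-join : ∀ {n} {B : Multi n} → Symm B → ∀ {u v} → Joined B u v → ∃ (BoundaryIs B (λ x → δ x u xor δ x v))
path-join {n} sB (here {v} _) = (λ _ _ → false) , (λ _ _ → refl) , (λ _ _ ()) , λ x → trans (⨁-false n) (sym (Bool.xor-same (δ x v)))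
path-join {n} {B} sB {u} {v} (step {w = w} _ _ e r) with path-join sB r
... | J , sJ , J≤B , bJ = J′ , (λ x y → cong₂ _xor_ (sJ x y) (sE x y)) , J′≤B , boundary
  where
  E J′ : Fin n → Fin n → Bool
  E x y = (δ x u ∧ δ y w) xor (δ x w ∧ δ y u)
  J′ x y = J x y xor E x y
  sE : ∀ x y → E x y ≡ E y x
  sE x y = trans (Bool.xor-comm (δ x u ∧ δ y w) _) (cong₂ _xor_ (Bool.∧-comm (δ x w) (δ y u)) (Bool.∧-comm (δ x u) (δ y w)))
  xor-true : ∀ a b → a xor b ≡ true → a ≡ true ⊎ b ≡ true
  xor-true true  b _ = inj₁ refl
  xor-true false b p = inj₂ p
  J′≤B : ∀ x y → J′ x y ≡ true → 0 < B x y
  J′≤B x y p with xor-true (J x y) (E x y) p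
  ... | inj₁ q = J≤B x y q
  ... | inj₂ q with xor-true (δ x u ∧ δ y w) (δ x w ∧ δ y u) q
  ...   | inj₁ a = subst₂ (λ a b → 0 < B a b) (sym (δ⇒≡ x u (proj₁ (∧-true a)))) (sym (δ⇒≡ y w (proj₂ (∧-true {δ x u} a)))) e
  ...   | inj₂ a = subst₂ (λ a b → 0 < B a b) (sym (δ⇒≡ x w (proj₁ (∧-true a)))) (sym (δ⇒≡ y u (proj₂ (∧-true {δ x w} a)))) (subst (0 <_) (sB u w) e)
  half : ∀ a x b → ⨁ (λ y → δ x a ∧ δ y b) ≡ δ x a
  half a x b = trans (⨁-∧ (δ x a) (λ y → δ y b)) (trans (cong (δ x a ∧_) (trans (⨁-cong (λ y → sym (Bool.∧-identityʳ (δ y b)))) (⨁-δ b (λ _ → true)))) (Bool.∧-identityʳ _))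
  boundary : ∀ x → ⨁ (J′ x) ≡ δ x u xor δ x v
  boundary x = trans (⨁-xor (J x) (E x)) (trans (cong₂ _xor_ (bJ x) (trans (⨁-xor (λ y → δ x u ∧ δ y w) (λ y → δ x w ∧ δ y u)) (cong₂ _xor_ (half u x w) (half w x u))))
    (cancel (δ x w) (δ x v) (δ x u)))
    where
    cancel : ∀ w v u → (w xor v) xor (u xor w) ≡ u xor v
    cancel true  true  true  = refl
    cancel true  true  false = refl
    cancel true  false true  = refl
    cancel true  false false = refl
    cancel false true  true  = refl
    cancel false true  false = refl
    cancel false false true  = refl
    cancel false false false = refl

-- The sum modulo 2 of walks from `r` to the vertices of T. Their contributions at the start `r`
-- cancel because |T| is even.
T-join : ∀ {n} {B : Multi n} → Symm B → ∀ r → (∀ v → Joined B r v) → ∀ t → ⨁ t ≡ false → ∃ (BoundaryIs B t)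
T-join {n} {B} sB r joined t even = J , sJ , J≤B , boundary
  where
  path : ∀ v → ∃ (BoundaryIs B (λ x → δ x r xor δ x v))
  path v = path-join sB (joined v)
  P : Fin n → Fin n → Fin n → Bool
  P v = proj₁ (path v)
  J : Fin n → Fin n → Bool
  J x y = ⨁ (λ v → t v ∧ P v x y)
  sJ : ∀ x y → J x y ≡ J y x
  sJ x y = ⨁-cong (λ v → cong (t v ∧_) (proj₁ (proj₂ (path v)) x y))
  J≤B : ∀ x y → J x y ≡ true → 0 < B x y
  J≤B x y p with ⨁-true (λ v → t v ∧ P v x y) p
  ... | v , q = proj₁ (proj₂ (proj₂ (path v))) x y (proj₂ (∧-true {t v} q))
  boundary : ∀ x → ⨁ (J x) ≡ t x
  boundary x = begin
    ⨁ (λ y → ⨁ (λ v → t v ∧ P v x y))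
      ≡⟨ ⨁-swap (λ y v → t v ∧ P v x y) ⟩
    ⨁ (λ v → ⨁ (λ y → t v ∧ P v x y))
      ≡⟨ ⨁-cong (λ v → trans (⨁-∧ (t v) (P v x)) (trans (cong (t v ∧_) (proj₂ (proj₂ (proj₂ (path v))) x)) (distribute (t v) (δ x r) (δ x v)))) ⟩
    ⨁ (λ v → (δ x r ∧ t v) xor (δ x v ∧ t v))
      ≡⟨ ⨁-xor (λ v → δ x r ∧ t v) (λ v → δ x v ∧ t v) ⟩
    ⨁ (λ v → δ x r ∧ t v) xor ⨁ (λ v → δ x v ∧ t v)
      ≡⟨ cong₂ _xor_ (trans (⨁-∧ (δ x r) t) (trans (cong (δ x r ∧_) even) (Bool.∧-zeroʳ (δ x r))))
           (trans (⨁-cong (λ v → cong (_∧ t v) (δ-sym x v))) (⨁-δ x t)) ⟩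
    t x ∎
    where
    open ≡-Reasoning
    distribute : ∀ a b c → a ∧ (b xor c) ≡ (b ∧ a) xor (c ∧ a)
    distribute true  true  true  = refl
    distribute true  true  false = refl
    distribute true  false true  = refl
    distribute true  false false = refl
    distribute false true  true  = refl
    distribute false true  false = refl
    distribute false false true  = refl
    distribute false false false = refl

-- Assembling the factor

two-or-four : ∀ d → 1 ≤ d → d ≤ 5 → parity d ≡ false → d ≡ 2 ⊎ d ≡ 4
two-or-four 2 _ _ _ = inj₁ refl
two-or-four 4 _ _ _ = inj₂ refl
two-or-four (suc (suc (suc (suc (suc (suc d)))))) _ (s≤s (s≤s (s≤s (s≤s (s≤s ()))))) _

connected24 : ∀ {n} (G : Graph n) → 2 ≤ n → (m : Multi n) → (∀ x y → m x y ≤ mult G x y) → (∀ x → deg m x ≤ 5) →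
  TwoConnectors m full → Connected24Factor G
connected24 {suc zero} G (s≤s ())
connected24 {suc (suc k)} G _ m m≤G small T = record
  { F = F
  ; F-sym = sF
  ; F-sub = λ x y → ≤-trans (F≤m x y) (m≤G x y)
  ; degree = λ v → subst (λ d → d ≡ 2 ⊎ d ≡ 4) (sym (outside-nothing v))
      (two-or-four (deg F v) (positive v) (≤-trans (∑-mono (F≤m v)) (small v)) (even v))
  ; connected = λ u v → joined-map (λ x y e → edge (≤-trans e (m≤m+n _ _))) (cA u v refl refl) }
  where
  open TwoConnectors T
  n = suc (suc k)
  t : Fin n → Bool
  t x = parity (deg A x)
  A-loopless : Loopless A
  A-loopless x = n≤0⇒n≡0 (≤-trans (m≤m+n _ _) (≤-trans (A+B≤ x x) (≤-trans (m≤G x x) (≤-reflexive (loopless G x)))))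
  t-even : ⨁ t ≡ false
  t-even with D-even A sA A-loopless full
  ... | e , eq = trans (sym (parity-∑ (deg A))) (trans (cong parity eq) (parity-double e))
  join : ∃ (BoundaryIs B t)
  join = T-join sB Fin.zero (λ v → cB Fin.zero v refl refl) t t-even
  J : Fin n → Fin n → Bool
  J = proj₁ join
  F : Multi n
  F x y = A x y + J x y ▸ 1
  sF : Symm F
  sF x y = cong₂ (λ a b → a + b ▸ 1) (sA x y) (proj₁ (proj₂ join) x y)
  F≤m : ∀ x y → F x y ≤ m x y
  F≤m x y = ≤-trans (+-monoʳ-≤ (A x y) (J≤ (bool (J x y)))) (A+B≤ x y)
    where
    J≤ : J x y ≡ true ⊎ J x y ≡ false → J x y ▸ 1 ≤ B x y
    J≤ (inj₁ p) = subst (λ b → b ▸ 1 ≤ B x y) (sym p) (proj₁ (proj₂ (proj₂ join)) x y p)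
    J≤ (inj₂ p) = subst (λ b → b ▸ 1 ≤ B x y) (sym p) z≤n
  even : ∀ x → parity (deg F x) ≡ false
  even x = begin
    parity (deg F x)                                ≡⟨ cong parity (∑-+ (A x) (λ y → J x y ▸ 1)) ⟩
    parity (deg A x + ∑ (λ y → J x y ▸ 1))          ≡⟨ parity-+ (deg A x) _ ⟩
    t x xor parity (∑ (λ y → J x y ▸ 1))            ≡⟨ cong (t x xor_) (trans (parity-∑ (λ y → J x y ▸ 1)) (⨁-cong (λ y → bit (J x y)))) ⟩
    t x xor ⨁ (J x)                                 ≡⟨ cong (t x xor_) (proj₂ (proj₂ (proj₂ join)) x) ⟩
    t x xor t x                                     ≡⟨ Bool.xor-same (t x) ⟩
    false ∎
    where
    open ≡-Reasoning
    bit : ∀ b → parity (b ▸ 1) ≡ b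
    bit true  = refl
    bit false = refl
  -- Degree 0 is even too; it is excluded because `A` joins every vertex to some other one.
  leave : ∀ {x y} → x ≢ y → Joined A x y → 1 ≤ deg F x
  leave ne (here _) = ⊥-elim (ne refl)
  leave {x} ne (step {w = w} _ _ e _) = ≤-trans (≤-trans e (m≤m+n _ _)) (∑-elem (F x) w)
  positive : ∀ x → 1 ≤ deg F x
  positive Fin.zero    = leave (λ ()) (cA Fin.zero (Fin.suc Fin.zero) refl refl)
  positive (Fin.suc x) = leave (λ ()) (cA (Fin.suc x) Fin.zero refl refl)
  outside-nothing : ∀ v → degOutside F Subset.⊥ v ≡ deg F v
  outside-nothing v = ∑-cong λ u → cong (λ b → if b then 0 else F v u) (lookup-replicate u false)

theorem7p11 : (n : ℕ) → 3 ≤ n → (G : Graph n) →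
    ((S : Subset n) (c : ℕ) → HasComponents G S c →
    (14 * c ≤ 4 * ∣ S ∣ + 14) × (14 * c + 21 * iso G S ≤ 7 * ∣ S ∣ + 14)) →
    Connected24Factor G
theorem7p11 (suc zero) (s≤s ())
theorem7p11 (suc (suc zero)) (s≤s (s≤s ()))
theorem7p11 (suc (suc (suc k))) _ G hyp = finish (Reduce.reduce g sg lg tg (excess T₀.graph) T₀ ≤-refl)
  where
  n = suc (suc (suc k))
  g = mult G
  sg = symmetric G
  lg = loopless G
  tg : Tough g
  tg = tough G (λ S c h → proj₂ (hyp S c h))
  T₀ : SpanningTight g
  T₀ = spanningTight (s≤s z≤n) g sg lg tg
  module T₀ = SpanningTight T₀
  finish : (∃ λ (T : SpanningTight g) → ∀ x → deg (SpanningTight.graph T) x ≤ 5) → Connected24Factor G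
  finish (T , small) = connected24 G (s≤s (s≤s z≤n)) T.graph T.≤g small
    (connectors n T.graph full Fin.zero (≤-reflexive (size-full n)) refl T.sy
      (λ x → n≤0⇒n≡0 (≤-trans (T.≤g x x) (≤-reflexive (lg x)))) T.sparse T.tight)
    where module T = SpanningTight T
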